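{- Let $r\in \mathbb{N}_0$ be fixed. For a uniformly random binary tree of size $n$, the expectation and variance of the number $X_{n;r}$ of $r$-branches satisfy, as $n\to\infty$, \[ \mathbb{E} X_{n;r} = \frac{n}{4^{r}} + \frac{1}{6} \Big(1 + \frac{5}{4^{r}}\Big) + \frac{1}{20 n}\Big(4^{r} - \frac{1}{4^{r}}\Big) + \frac{1}{12 n^{2}} \Big(\frac{5\cdot 16^{r}}{21} - \frac{7\cdot 4^{r}}{10} + \frac{97}{210\cdot 4^{r}}\Big) + O(n^{ -3}), \] \[ \mathbb{V} X_{n;r} = \frac{4^r-1}{3\cdot 16^r} n - \frac{2\cdot 16^{r} - 25\cdot 4^{r} + 23}{90\cdot 16^{r}} - \frac{13\cdot 64^{r} - 14\cdot 16^{r} + 7\cdot 4^{r} - 6}{420\cdot 16^{r} n} + O(n^{ -2}). \]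
   Context: A binary tree is either a leaf $\square$ or an inner node with an ordered pair of binary subtrees; its size is the number of inner nodes, and all $C_n=\frac1{n+1}\binom{2n}{n}$ trees of size $n$ are equally likely. The register function is defined by $\mathrm{Reg}(\square)=0$ and, for a tree with subtrees $t_1,t_2$, $\mathrm{Reg}(t)=\max\{\mathrm{Reg}(t_1),\mathrm{Reg}(t_2)\}$ if these differ and $\mathrm{Reg}(t_1)+1$ otherwise. Label every node (inner node or leaf) by the register function of the subtree rooted there. An $r$-branch is a maximal connected set of nodes all labeled $r$. $X_{n;r}$ is the number of $r$-branches of a random tree of size $n$. -}

module Defs where

open import Data.Nat as ℕ using (ℕ; zero; suc; _^_; _⊔_; _≡ᵇ_)
open import Data.Nat.Properties using (m^n≢0)
open import Data.Bool using (Bool; true; false; if_then_else_; _∧_; not)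
open import Data.List using (List; []; _∷_; concatMap; filter; length; map)
open import Data.Nat.ListAction using (sum)
open import Data.Integer using (+_)
open import Data.Rational as ℚ using (ℚ; _/_)
open import Relation.Nullary.Decidable using (⌊_⌋)
import Relation.Binary.PropositionalEquality as Eq

data Tree : Set where
  leaf : Tree
  node : Tree → Tree → Tree

size : Tree → ℕ
size leaf       = 0
size (node l r) = suc (size l ℕ.+ size r)

reg : Tree → ℕ
reg leaf       = 0
reg (node a b) = if reg a ≡ᵇ reg b then suc (reg a) else reg a ⊔ reg b

byHeight : ℕ → List Tree
byHeight zero    = leaf ∷ []
byHeight (suc h) = leaf ∷ concatMap (λ l → map (node l) (byHeight h)) (byHeight h)

-- all trees of size n (a tree of size n has height ≤ n), each exactly once
treesOfSize : ℕ → List Tree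
treesOfSize n = filter (λ t → size t ℕ.≟ n) (byHeight n)

ind : Bool → ℕ
ind true  = 1
ind false = 0

-- Counting r-branches: every r-branch (maximal connected set of nodes labeled r)
-- has a unique topmost node, namely a node labeled r whose parent is not labeled r
-- (or which is the root). topsBelow r t counts such nodes strictly below the root of t.
topsBelow : ℕ → Tree → ℕ
topsBelow r leaf       = 0
topsBelow r (node a b) =
  ind ((reg a ≡ᵇ r) ∧ not (reg (node a b) ≡ᵇ r)) ℕ.+ topsBelow r a ℕ.+
  ind ((reg b ≡ᵇ r) ∧ not (reg (node a b) ≡ᵇ r)) ℕ.+ topsBelow r b

branches : ℕ → Tree → ℕ
branches r t = ind (reg t ≡ᵇ r) ℕ.+ topsBelow r t

ℕ→ℚ : ℕ → ℚ
ℕ→ℚ n = (+ n) / 1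

-- 1/n for n ≥ 1 (value at 0 is irrelevant; set to 0)
recipℕ : ℕ → ℚ
recipℕ zero    = ℚ.0ℚ
recipℕ (suc m) = (+ 1) / suc m

inv4^ : ℕ → ℚ
inv4^ r = _/_ (+ 1) (4 ^ r) {{m^n≢0 4 r}}

expect : ℕ → (Tree → ℕ) → ℚ
expect n f = ℕ→ℚ (sum (map f (treesOfSize n))) ℚ.* recipℕ (length (treesOfSize n))

EX : ℕ → ℕ → ℚ
EX r n = expect n (branches r)

VX : ℕ → ℕ → ℚ
VX r n = expect n (λ t → branches r t ℕ.* branches r t) ℚ.- (EX r n ℚ.* EX r n)

EXmain : ℕ → ℕ → ℚ
EXmain r n =
  let a = inv4^ r ; b = ℕ→ℚ (4 ^ r) ; m = ℕ→ℚ n ; i = recipℕ n in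
  m ℚ.* a
  ℚ.+ ((+ 1) / 6) ℚ.* (ℚ.1ℚ ℚ.+ ((+ 5) / 1) ℚ.* a)
  ℚ.+ ((+ 1) / 20) ℚ.* i ℚ.* (b ℚ.- a)
  ℚ.+ ((+ 1) / 12) ℚ.* (i ℚ.* i) ℚ.*
      (((+ 5) / 21) ℚ.* (b ℚ.* b) ℚ.- ((+ 7) / 10) ℚ.* b ℚ.+ ((+ 97) / 210) ℚ.* a)

VXmain : ℕ → ℕ → ℚ
VXmain r n =
  let a = inv4^ r ; b = ℕ→ℚ (4 ^ r) ; m = ℕ→ℚ n ; i = recipℕ n in
  ((b ℚ.- ℚ.1ℚ) ℚ.* ((+ 1) / 3) ℚ.* (a ℚ.* a)) ℚ.* m
  ℚ.- (((+ 2) / 1) ℚ.* (b ℚ.* b) ℚ.- ((+ 25) / 1) ℚ.* b ℚ.+ ((+ 23) / 1))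
        ℚ.* ((+ 1) / 90) ℚ.* (a ℚ.* a)
  ℚ.- (((+ 13) / 1) ℚ.* (b ℚ.* b ℚ.* b) ℚ.- ((+ 14) / 1) ℚ.* (b ℚ.* b)
        ℚ.+ ((+ 7) / 1) ℚ.* b ℚ.- ((+ 6) / 1))
        ℚ.* ((+ 1) / 420) ℚ.* (a ℚ.* a) ℚ.* i

{-# OPTIONS --safe #-}

-- Cutting off all leaves of a tree and contracting the nodes left with one child lowers every
-- register label by one, so the (r+1)-branches of t are the r-branches of the reduced tree. A tree
-- with k inner nodes arises from trees counted by (z / (1 - 2z))²ᵏ⁺¹, hence passing from r to r + 1
-- is a positive linear operator L on the totals over all trees of size n. In terms of the shift
-- operator and N = 4 - shift, L intertwines A ↦ N A with a shifted N, so L maps H k = Nᵏ C (C the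
-- Catalan numbers, H k n / C n = Θ(n⁻ᵏ)) to a mere shift of H k. Thus L preserves the error class
-- O(H k) by positivity, and induction on r shows that the first and second moments are explicit
-- combinations of n (n+1) C, (n+1) C, C, H 1, H 2 up to such errors. Dividing by C n and expanding
-- H k n / C n in powers of 1/n gives the theorem; no complex analysis is needed.
module Submission where

open import Defs
open import Algebra.Bundles using (CommutativeSemiring)
open import Algebra.Structures using (IsCommutativeRing; IsCommutativeSemiring)
import Algebra.Solver.Ring.NaturalCoefficients.Default as NaturalCoefficientsSolver
open import Data.Bool using (_∧_; not)
open import Data.Bool.Properties using (∧-inverseʳ; ∧-identityʳ; if-float)
import Data.Integer as ℤ
import Data.Integer.Properties as ℤₚ
open import Data.List using (List; []; _∷_; _++_; concatMap; filter; length; map; upTo)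
open import Data.List.Membership.Propositional using (_∈_)
open import Data.List.Membership.Propositional.Properties using (∈-map⁻; ∈-upTo⁻; ∈-filter⁻)
open import Data.List.Properties using (filter-accept; filter-reject; map-upTo)
open import Data.List.Relation.Unary.Any using (here; there)
open import Data.Nat as ℕ using (ℕ; zero; suc; z≤n; s≤s; _≤_; _≡ᵇ_)
open import Data.Nat.ListAction using (sum)
import Data.Nat.Properties as ℕₚ
open import Data.Nat.Tactic.RingSolver using () renaming (solve-∀ to ℕ-solve-∀)
open import Data.Product using (_×_; _,_; proj₁; proj₂; ∃-syntax; map₁)
open import Function using (_∘_)
open import Relation.Binary.PropositionalEquality hiding (J)
open import Relation.Nullary using (yes; no; contradiction)
open import Relation.Nullary.Decidable using (dec⇒maybe)
open import Tactic.RingSolver using (solve-∀)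
open import Tactic.RingSolver.Core.AlmostCommutativeRing using (AlmostCommutativeRing; fromCommutativeRing)

-- Put σ(z) = z²/(1 - 2z)². This substitution fixes z = 1/4, the dominant singularity of the Catalan
-- series, and satisfies 4 - 1/σ = (4 - 1/z)/z. That is why `N` passes through `L` at the cost of
-- one shift. A shift multiplies by 4 to leading order, so one reduction multiplies the `H k`
-- component by about 4ᵏ, while (n+1)C and n(n+1)C behave like k = -1 and k = -2. This is the source
-- of the powers of 4ʳ in the theorem. The precision is dictated by the variance. The mean contains
-- n/4ʳ, so squaring it turns an error of order n⁻³ in the mean into one of order n⁻². The mean is
-- therefore followed up to an error O(`H 3`), the second moment up to O(`H 2`). The coefficients
-- depend on r through a = 4⁻ʳ and b = 4ʳ. Both are kept as independent variables of polynomial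
-- identities, and ab = 1 is inserted by hand when the variance is compared.

record CommSemiring : Set₁ where
  infixl 7 _*_
  infixl 6 _+_
  field
    Carrier : Set
    _+_ _*_ : Carrier → Carrier → Carrier
    0# 1#   : Carrier
    isCommutativeSemiring : IsCommutativeSemiring _≡_ _+_ _*_ 0# 1#

  open IsCommutativeSemiring isCommutativeSemiring public
    using (+-assoc; +-comm; +-identityˡ; +-identityʳ; *-assoc; *-comm; *-identityˡ; *-identityʳ; zeroˡ; zeroʳ; distribˡ)

  commutativeSemiring : CommutativeSemiring _ _
  commutativeSemiring = record { isCommutativeSemiring = isCommutativeSemiring }

  2# 4# : Carrier
  2# = 1# + 1#
  4# = 2# + 2#

-- Reduction of trees

-- The value at `leaf` is a placeholder: nothing is left of a lone leaf once leaves are cut off. The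
-- recursive calls and the lemmas on `reduce` concern inner nodes only.
reduce : Tree → Tree
reduce leaf                            = leaf
reduce (node leaf leaf)                = leaf
reduce (node leaf b@(node _ _))        = reduce b
reduce (node a@(node _ _) leaf)        = reduce a
reduce (node a@(node _ _) b@(node _ _)) = node (reduce a) (reduce b)

-- An inner node beside a leaf has a positive label, so the maximum passes this label on unchanged
-- and contraction loses nothing. With two inner children both labels drop by one, and the rule
-- defining `reg` commutes with `suc`.
reg-reduce : ∀ a b → reg (node a b) ≡ suc (reg (reduce (node a b)))
reg-reduce leaf         leaf         = refl
reg-reduce leaf         (node b₁ b₂) rewrite reg-reduce b₁ b₂ = refl
reg-reduce (node a₁ a₂) leaf         rewrite reg-reduce a₁ a₂ = refl
reg-reduce (node a₁ a₂) (node b₁ b₂) rewrite reg-reduce a₁ a₂ | reg-reduce b₁ b₂ =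
  sym (if-float suc (reg (reduce (node a₁ a₂)) ≡ᵇ reg (reduce (node b₁ b₂))))

top : ℕ → ℕ → ℕ → ℕ
top r child parent = ind ((child ≡ᵇ r) ∧ not (parent ≡ᵇ r))

top-vanishes : ∀ r {child parent} → parent ≡ child → top r child parent ≡ 0
top-vanishes r {child} refl = cong ind (∧-inverseʳ (child ≡ᵇ r))

-- A node with exactly one inner child carries that child's label, so no branch starts at the child
-- and the edge can be contracted. Leaves have label 0 and never start a branch of label `suc r`.
topsBelow-reduce : ∀ r a b → topsBelow (suc r) (node a b) ≡ topsBelow r (reduce (node a b))
topsBelow-reduce r leaf leaf = refl
topsBelow-reduce r leaf b@(node b₁ b₂) = trans
  (cong (ℕ._+ topsBelow (suc r) b) (top-vanishes (suc r) (trans (reg-reduce leaf b) (sym (reg-reduce b₁ b₂)))))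
  (topsBelow-reduce r b₁ b₂)
topsBelow-reduce r a@(node a₁ a₂) leaf = begin
  top (suc r) (reg a) (reg (node a leaf)) ℕ.+ topsBelow (suc r) a ℕ.+ 0 ℕ.+ 0
    ≡⟨ trans (ℕₚ.+-identityʳ _) (ℕₚ.+-identityʳ _) ⟩
  top (suc r) (reg a) (reg (node a leaf)) ℕ.+ topsBelow (suc r) a
    ≡⟨ cong (ℕ._+ topsBelow (suc r) a) (top-vanishes (suc r) (trans (reg-reduce a leaf) (sym (reg-reduce a₁ a₂)))) ⟩
  topsBelow (suc r) a
    ≡⟨ topsBelow-reduce r a₁ a₂ ⟩
  topsBelow r (reduce a) ∎
  where open ≡-Reasoning
topsBelow-reduce r a@(node a₁ a₂) b@(node b₁ b₂) = begin
  combine (reg a) (reg b) (reg (node a b)) (topsBelow (suc r) a) (topsBelow (suc r) b)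
    ≡⟨ cong₂ (combine (reg a) (reg b) (reg (node a b))) (topsBelow-reduce r a₁ a₂) (topsBelow-reduce r b₁ b₂) ⟩
  combine (reg a) (reg b) (reg (node a b)) (topsBelow r (reduce a)) (topsBelow r (reduce b))
    ≡⟨ cong (λ k → combine (reg a) (reg b) k (topsBelow r (reduce a)) (topsBelow r (reduce b))) (reg-reduce a b) ⟩
  combine (reg a) (reg b) (suc (reg (reduce (node a b)))) (topsBelow r (reduce a)) (topsBelow r (reduce b))
    ≡⟨ cong₂ (λ k l → combine k l (suc (reg (reduce (node a b)))) (topsBelow r (reduce a)) (topsBelow r (reduce b)))
         (reg-reduce a₁ a₂) (reg-reduce b₁ b₂) ⟩
  -- Once all three labels are successors, `suc x ≡ᵇ suc r` computes to `x ≡ᵇ r`.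
  topsBelow r (reduce (node a b)) ∎
  where
  open ≡-Reasoning
  combine : ℕ → ℕ → ℕ → ℕ → ℕ → ℕ
  combine x y p u v = top (suc r) x p ℕ.+ u ℕ.+ top (suc r) y p ℕ.+ v

branches-reduce : ∀ r a b → branches (suc r) (node a b) ≡ branches r (reduce (node a b))
branches-reduce r a b = cong₂ ℕ._+_ (cong (λ k → ind (k ≡ᵇ suc r)) (reg-reduce a b)) (topsBelow-reduce r a b)

-- By `reg-reduce` inner nodes have positive labels, so every leaf is a branch of its own, and a
-- tree has one more leaf than inner nodes.
branches-zero : ∀ t → branches 0 t ≡ suc (size t)
branches-zero leaf       = refl
branches-zero (node a b) = begin
  branches 0 (node a b)
    ≡⟨ cong (λ k → ind (k ≡ᵇ 0) ℕ.+ topsBelow 0 (node a b)) (reg-reduce a b) ⟩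
  topsBelow 0 (node a b)
    ≡⟨ cong₂ (λ u v → u ℕ.+ topsBelow 0 a ℕ.+ v ℕ.+ topsBelow 0 b) (uncovered a) (uncovered b) ⟩
  ind (reg a ≡ᵇ 0) ℕ.+ topsBelow 0 a ℕ.+ ind (reg b ≡ᵇ 0) ℕ.+ topsBelow 0 b
    ≡⟨ ℕₚ.+-assoc (branches 0 a) (ind (reg b ≡ᵇ 0)) (topsBelow 0 b) ⟩
  branches 0 a ℕ.+ branches 0 b
    ≡⟨ cong₂ ℕ._+_ (branches-zero a) (branches-zero b) ⟩
  suc (size a) ℕ.+ suc (size b)
    ≡⟨ cong suc (ℕₚ.+-suc (size a) (size b)) ⟩
  suc (size (node a b)) ∎
  where
  open ≡-Reasoning
  uncovered : ∀ t → top 0 (reg t) (reg (node a b)) ≡ ind (reg t ≡ᵇ 0)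
  uncovered t = trans (cong (top 0 (reg t)) (reg-reduce a b)) (cong ind (∧-identityʳ (reg t ≡ᵇ 0)))

-- Sums over all trees of a given size

module TreeSums (R : CommSemiring) where

  open CommSemiring R renaming (Carrier to K)
  open NaturalCoefficientsSolver commutativeSemiring

  cancel-zeroˡ : ∀ {x y} → x ≡ 0# → x + y ≡ y
  cancel-zeroˡ {y = y} x≡0 = trans (cong (_+ y) x≡0) (+-identityˡ y)

  ∑ : {A : Set} → List A → (A → K) → K
  ∑ []       f = 0#
  ∑ (x ∷ xs) f = f x + ∑ xs f

  module _ {A : Set} where

    ∑-cong∈ : ∀ (xs : List A) {f g} → (∀ {x} → x ∈ xs → f x ≡ g x) → ∑ xs f ≡ ∑ xs g
    ∑-cong∈ []       eq = refl
    ∑-cong∈ (x ∷ xs) eq = cong₂ _+_ (eq (here refl)) (∑-cong∈ xs (eq ∘ there))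

    ∑-cong : ∀ (xs : List A) {f g} → (∀ x → f x ≡ g x) → ∑ xs f ≡ ∑ xs g
    ∑-cong xs eq = ∑-cong∈ xs (λ {x} _ → eq x)

    ∑-0 : ∀ (xs : List A) → ∑ xs (λ _ → 0#) ≡ 0#
    ∑-0 []       = refl
    ∑-0 (x ∷ xs) = trans (+-identityˡ _) (∑-0 xs)

    ∑-+ : ∀ (xs : List A) f g → ∑ xs (λ x → f x + g x) ≡ ∑ xs f + ∑ xs g
    ∑-+ []       f g = sym (+-identityˡ 0#)
    ∑-+ (x ∷ xs) f g = trans (cong (f x + g x +_) (∑-+ xs f g)) (interchange (f x) (g x) _ _)
      where
      interchange : ∀ a b c d → a + b + (c + d) ≡ a + c + (b + d)
      interchange = solve 4 (λ a b c d → a :+ b :+ (c :+ d) := a :+ c :+ (b :+ d)) refl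

    ∑-*ˡ : ∀ (xs : List A) c f → ∑ xs (λ x → c * f x) ≡ c * ∑ xs f
    ∑-*ˡ []       c f = sym (zeroʳ c)
    ∑-*ˡ (x ∷ xs) c f = trans (cong (c * f x +_) (∑-*ˡ xs c f)) (sym (distribˡ c (f x) _))

    ∑-++ : ∀ (xs ys : List A) f → ∑ (xs ++ ys) f ≡ ∑ xs f + ∑ ys f
    ∑-++ []       ys f = sym (+-identityˡ _)
    ∑-++ (x ∷ xs) ys f = trans (cong (f x +_) (∑-++ xs ys f)) (sym (+-assoc (f x) _ _))

  module _ {A B : Set} where

    ∑-map : ∀ (h : A → B) xs f → ∑ (map h xs) f ≡ ∑ xs (f ∘ h)
    ∑-map h []       f = refl
    ∑-map h (x ∷ xs) f = cong (f (h x) +_) (∑-map h xs f)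

    ∑-concatMap : ∀ (h : A → List B) xs f → ∑ (concatMap h xs) f ≡ ∑ xs (λ x → ∑ (h x) f)
    ∑-concatMap h []       f = refl
    ∑-concatMap h (x ∷ xs) f =
      trans (∑-++ (h x) (concatMap h xs) f) (cong (∑ (h x) f +_) (∑-concatMap h xs f))

    ∑-swap : ∀ (xs : List A) (ys : List B) (f : A → B → K) →
      ∑ xs (λ x → ∑ ys (f x)) ≡ ∑ ys (λ y → ∑ xs (λ x → f x y))
    ∑-swap []       ys f = sym (∑-0 ys)
    ∑-swap (x ∷ xs) ys f =
      trans (cong (∑ ys (f x) +_) (∑-swap xs ys f)) (sym (∑-+ ys (f x) _))

  δ : ℕ → ℕ → K
  δ zero    zero    = 1#
  δ zero    (suc n) = 0#
  δ (suc m) zero    = 0#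
  δ (suc m) (suc n) = δ m n

  δ-refl : ∀ n → δ n n ≡ 1#
  δ-refl zero    = refl
  δ-refl (suc n) = δ-refl n

  δ-≢ : ∀ {m n} → m ≢ n → δ m n ≡ 0#
  δ-≢ {zero}  {zero}  m≢n = contradiction refl m≢n
  δ-≢ {zero}  {suc n} m≢n = refl
  δ-≢ {suc m} {zero}  m≢n = refl
  δ-≢ {suc m} {suc n} m≢n = δ-≢ (m≢n ∘ cong suc)

  ∑-filter-≟ : ∀ {A : Set} (s : A → ℕ) n xs f →
    ∑ (filter (λ x → s x ℕ.≟ n) xs) f ≡ ∑ xs (λ x → δ (s x) n * f x)
  ∑-filter-≟ s n []       f = refl
  ∑-filter-≟ s n (x ∷ xs) f with s x ℕ.≟ n
  ... | yes s≡n = trans (cong (λ ys → ∑ ys f) (filter-accept (λ x → s x ℕ.≟ n) s≡n))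
                         (cong₂ _+_ (sym unit) (∑-filter-≟ s n xs f))
    where
    unit : δ (s x) n * f x ≡ f x
    unit = trans (cong (_* f x) (trans (cong (δ (s x)) (sym s≡n)) (δ-refl (s x)))) (*-identityˡ (f x))
  ... | no  s≢n = trans (cong (λ ys → ∑ ys f) (filter-reject (λ x → s x ℕ.≟ n) s≢n))
                         (trans (∑-filter-≟ s n xs f) (sym drop))
    where
    drop : δ (s x) n * f x + ∑ xs (λ x → δ (s x) n * f x) ≡ ∑ xs (λ x → δ (s x) n * f x)
    drop = cancel-zeroˡ (trans (cong (_* f x) (δ-≢ s≢n)) (zeroˡ (f x)))

  antidiag : ℕ → List (ℕ × ℕ)
  antidiag zero    = (0 , 0) ∷ []
  antidiag (suc n) = (0 , suc n) ∷ map (map₁ suc) (antidiag n)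

  antidiag-suc : ∀ n f →
    ∑ (antidiag (suc n)) f ≡ f (0 , suc n) + ∑ (antidiag n) (f ∘ map₁ suc)
  antidiag-suc n f = cong (f (0 , suc n) +_) (∑-map (map₁ suc) (antidiag n) f)

  ∈-antidiag : ∀ n {p} → p ∈ antidiag n → proj₁ p ℕ.+ proj₂ p ≡ n
  ∈-antidiag zero    (here refl) = refl
  ∈-antidiag (suc n) (here refl) = refl
  ∈-antidiag (suc n) (there p∈)  with ∈-map⁻ (map₁ suc) p∈
  ... | q , q∈ , refl = cong suc (∈-antidiag n q∈)

  ∈-antidiag-≤₁ : ∀ n {p} → p ∈ antidiag n → proj₁ p ≤ n
  ∈-antidiag-≤₁ n {p} p∈ = ℕₚ.≤-trans (ℕₚ.m≤m+n (proj₁ p) (proj₂ p)) (ℕₚ.≤-reflexive (∈-antidiag n p∈))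

  ∈-antidiag-≤₂ : ∀ n {p} → p ∈ antidiag n → proj₂ p ≤ n
  ∈-antidiag-≤₂ n {p} p∈ = ℕₚ.≤-trans (ℕₚ.m≤n+m (proj₂ p) (proj₁ p)) (ℕₚ.≤-reflexive (∈-antidiag n p∈))

  ∑-antidiag-δˡ : ∀ n (f : ℕ → K) → ∑ (antidiag n) (λ p → δ 0 (proj₁ p) * f (proj₂ p)) ≡ f n
  ∑-antidiag-δˡ zero    f = trans (+-identityʳ _) (*-identityˡ (f 0))
  ∑-antidiag-δˡ (suc n) f = begin
    ∑ (antidiag (suc n)) (λ p → δ 0 (proj₁ p) * f (proj₂ p))
      ≡⟨ antidiag-suc n (λ p → δ 0 (proj₁ p) * f (proj₂ p)) ⟩
    1# * f (suc n) + ∑ (antidiag n) (λ p → 0# * f (proj₂ p))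
      ≡⟨ cong₂ _+_ (*-identityˡ (f (suc n))) (∑-*ˡ (antidiag n) 0# (f ∘ proj₂)) ⟩
    f (suc n) + 0# * ∑ (antidiag n) (f ∘ proj₂)
      ≡⟨ cong (f (suc n) +_) (zeroˡ _) ⟩
    f (suc n) + 0#
      ≡⟨ +-identityʳ _ ⟩
    f (suc n) ∎
    where open ≡-Reasoning

  ∑-antidiag-swap : ∀ n f → ∑ (antidiag n) f ≡ ∑ (antidiag n) (λ p → f (proj₂ p , proj₁ p))
  ∑-antidiag-swap n f = trans (flip n f) (sym (flip′ n f))
    where
    open ≡-Reasoning
    -- Both sums are compared with one recursion that peels off the pair with first entry 0.
    -- `shiftedʳ` peels off the pair with second entry 0 instead, which is how the flipped sum
    -- unfolds.
    shifted : ℕ → (ℕ × ℕ → K) → K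
    shifted zero    f = f (0 , 0)
    shifted (suc n) f = f (0 , suc n) + shifted n (f ∘ map₁ suc)
    shiftedʳ : ∀ n f → shifted (suc n) f ≡ f (suc n , 0) + shifted n (λ p → f (proj₁ p , suc (proj₂ p)))
    shiftedʳ zero    f = +-comm _ _
    shiftedʳ (suc n) f = trans (cong (f (0 , suc (suc n)) +_) (shiftedʳ n (f ∘ map₁ suc))) (rot _ _ _)
      where
      rot : ∀ a b c → a + (b + c) ≡ b + (a + c)
      rot = solve 3 (λ a b c → a :+ (b :+ c) := b :+ (a :+ c)) refl
    flip : ∀ n f → ∑ (antidiag n) f ≡ shifted n f
    flip zero    f = +-identityʳ _
    flip (suc n) f = trans (antidiag-suc n f) (cong (f (0 , suc n) +_) (flip n _))
    flip′ : ∀ n f → ∑ (antidiag n) (λ p → f (proj₂ p , proj₁ p)) ≡ shifted n f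
    flip′ zero    f = +-identityʳ _
    flip′ (suc n) f = begin
      ∑ (antidiag (suc n)) (λ p → f (proj₂ p , proj₁ p))
        ≡⟨ antidiag-suc n (λ p → f (proj₂ p , proj₁ p)) ⟩
      f (suc n , 0) + ∑ (antidiag n) (λ p → f (proj₂ p , suc (proj₁ p)))
        ≡⟨ cong (f (suc n , 0) +_) (flip′ n (λ p → f (proj₁ p , suc (proj₂ p)))) ⟩
      f (suc n , 0) + shifted n (λ p → f (proj₁ p , suc (proj₂ p)))
        ≡⟨ shiftedʳ n f ⟨
      shifted (suc n) f ∎

  ∑-antidiag-δʳ : ∀ n (f : ℕ → K) → ∑ (antidiag n) (λ p → δ 0 (proj₂ p) * f (proj₁ p)) ≡ f n
  ∑-antidiag-δʳ n f = trans (∑-antidiag-swap n _) (∑-antidiag-δˡ n f)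

  ∑-antidiag-δδ : ∀ p q n → ∑ (antidiag n) (λ ij → δ p (proj₁ ij) * δ q (proj₂ ij)) ≡ δ (p ℕ.+ q) n
  ∑-antidiag-δδ zero    q n       = ∑-antidiag-δˡ n (δ q)
  ∑-antidiag-δδ (suc p) q zero    = trans (+-identityʳ _) (zeroˡ (δ q 0))
  ∑-antidiag-δδ (suc p) q (suc n) = begin
    ∑ (antidiag (suc n)) (λ ij → δ (suc p) (proj₁ ij) * δ q (proj₂ ij))
      ≡⟨ antidiag-suc n (λ ij → δ (suc p) (proj₁ ij) * δ q (proj₂ ij)) ⟩
    0# * δ q (suc n) + ∑ (antidiag n) (λ ij → δ p (proj₁ ij) * δ q (proj₂ ij))
      ≡⟨ cong₂ _+_ (zeroˡ (δ q (suc n))) (∑-antidiag-δδ p q n) ⟩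
    0# + δ (p ℕ.+ q) n
      ≡⟨ +-identityˡ _ ⟩
    δ (p ℕ.+ q) n ∎
    where open ≡-Reasoning

  -- coeff m n is the coefficient of zⁿ in (z / (1 - 2z))ᵐ.
  coeff : ℕ → ℕ → K
  coeff zero    n       = δ 0 n
  coeff (suc m) zero    = 0#
  coeff (suc m) (suc n) = coeff m n + 2# * coeff (suc m) n

  -- With T = z/(1 - 2z), the recursion of `coeff` reads (1 - 2z)Tᵐ⁺¹ = zTᵐ. Applied to the first
  -- factor, it drives the induction on `a` and `n`.
  coeff-convolution : ∀ a b n → ∑ (antidiag n) (λ p → coeff a (proj₁ p) * coeff b (proj₂ p)) ≡ coeff (a ℕ.+ b) n
  coeff-convolution zero    b n       = ∑-antidiag-δˡ n (coeff b)
  coeff-convolution (suc a) b zero    = trans (+-identityʳ _) (zeroˡ (coeff b 0))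
  coeff-convolution (suc a) b (suc n) = begin
    ∑ (antidiag (suc n)) (λ p → coeff (suc a) (proj₁ p) * coeff b (proj₂ p))
      ≡⟨ antidiag-suc n (λ p → coeff (suc a) (proj₁ p) * coeff b (proj₂ p)) ⟩
    0# * coeff b (suc n) + ∑ (antidiag n) (λ p → (coeff a (proj₁ p) + 2# * coeff (suc a) (proj₁ p)) * coeff b (proj₂ p))
      ≡⟨ cong₂ _+_ (zeroˡ (coeff b (suc n))) (∑-cong (antidiag n) (λ p → expand 2# (coeff a (proj₁ p)) _ (coeff b (proj₂ p)))) ⟩
    0# + ∑ (antidiag n) (λ p → coeff a (proj₁ p) * coeff b (proj₂ p) + 2# * (coeff (suc a) (proj₁ p) * coeff b (proj₂ p)))
      ≡⟨ trans (+-identityˡ _) (∑-+ (antidiag n) _ _) ⟩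
    ∑ (antidiag n) (λ p → coeff a (proj₁ p) * coeff b (proj₂ p)) + ∑ (antidiag n) (λ p → 2# * (coeff (suc a) (proj₁ p) * coeff b (proj₂ p)))
      ≡⟨ cong₂ _+_ (coeff-convolution a b n) (trans (∑-*ˡ (antidiag n) 2# _) (cong (2# *_) (coeff-convolution (suc a) b n))) ⟩
    coeff (a ℕ.+ b) n + 2# * coeff (suc a ℕ.+ b) n ∎
    where
    open ≡-Reasoning
    expand : ∀ t x y z → (x + t * y) * z ≡ x * z + t * (y * z)
    expand = solve 4 (λ t x y z → (x :+ t :* y) :* z := x :* z :+ t :* (y :* z)) refl

  coeff-vanishes : ∀ {m n} → n ℕ.< m → coeff m n ≡ 0#
  coeff-vanishes {suc m} {zero}  _         = refl
  coeff-vanishes {suc m} {suc n} (s≤s n<m) = trans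
    (cong₂ (λ x y → x + 2# * y) (coeff-vanishes n<m) (coeff-vanishes (ℕₚ.m<n⇒m<1+n n<m)))
    (trans (+-identityˡ _) (zeroʳ 2#))

  -- Sums over trees with separate height bound and size

  sumOver : ℕ → ℕ → (Tree → K) → K
  sumOver h n f = ∑ (filter (λ t → size t ℕ.≟ n) (byHeight h)) f

  sumOver-δ : ∀ h n f → sumOver h n f ≡ ∑ (byHeight h) (λ t → δ (size t) n * f t)
  sumOver-δ h n f = ∑-filter-≟ size n (byHeight h) f

  ∑-byHeight-suc : ∀ h f →
    ∑ (byHeight (suc h)) f ≡ f leaf + ∑ (byHeight h) (λ a → ∑ (byHeight h) (λ b → f (node a b)))
  ∑-byHeight-suc h f = cong (f leaf +_)
    (trans (∑-concatMap (λ a → map (node a) (byHeight h)) (byHeight h) f)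
           (∑-cong (byHeight h) (λ a → ∑-map (node a) (byHeight h) f)))

  sumOver-zero : ∀ h f → sumOver h 0 f ≡ f leaf
  sumOver-zero zero    f = +-identityʳ _
  sumOver-zero (suc h) f = begin
    sumOver (suc h) 0 f
      ≡⟨ sumOver-δ (suc h) 0 f ⟩
    ∑ (byHeight (suc h)) (λ t → δ (size t) 0 * f t)
      ≡⟨ ∑-byHeight-suc h (λ t → δ (size t) 0 * f t) ⟩
    1# * f leaf + ∑ (byHeight h) (λ a → ∑ (byHeight h) (λ b → 0# * f (node a b)))
      ≡⟨ cong₂ _+_ (*-identityˡ (f leaf)) (trans (∑-cong (byHeight h) (λ a →
           trans (∑-cong (byHeight h) (λ b → zeroˡ (f (node a b)))) (∑-0 (byHeight h)))) (∑-0 (byHeight h))) ⟩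
    f leaf + 0#
      ≡⟨ +-identityʳ _ ⟩
    f leaf ∎
    where open ≡-Reasoning

  sumOver-suc : ∀ h n f →
    sumOver (suc h) (suc n) f ≡
    ∑ (antidiag n) (λ p → sumOver h (proj₁ p) (λ a → sumOver h (proj₂ p) (λ b → f (node a b))))
  sumOver-suc h n f = begin
    sumOver (suc h) (suc n) f
      ≡⟨ sumOver-δ (suc h) (suc n) f ⟩
    ∑ (byHeight (suc h)) (λ t → δ (size t) (suc n) * f t)
      ≡⟨ ∑-byHeight-suc h (λ t → δ (size t) (suc n) * f t) ⟩
    0# * f leaf + ∑ ts (λ a → ∑ ts (λ b → δ (size a ℕ.+ size b) n * f (node a b)))
      ≡⟨ cancel-zeroˡ (zeroˡ (f leaf)) ⟩
    ∑ ts (λ a → ∑ ts (λ b → δ (size a ℕ.+ size b) n * f (node a b)))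
      -- `∑-antidiag-δδ` resolves the condition on the joint size into all splittings of n, after
      -- which the two subtrees are constrained independently.
      ≡⟨ ∑-cong ts (λ a → ∑-cong ts (λ b → split a b)) ⟩
    ∑ ts (λ a → ∑ ts (λ b → ∑ (antidiag n) (λ p → δ (size a) (proj₁ p) * (δ (size b) (proj₂ p) * f (node a b)))))
      ≡⟨ ∑-cong ts (λ a → trans (∑-swap ts (antidiag n) _)
           (∑-cong (antidiag n) (λ p → trans (∑-*ˡ ts (δ (size a) (proj₁ p)) _)
             (cong (δ (size a) (proj₁ p) *_) (sym (sumOver-δ h (proj₂ p) (λ b → f (node a b)))))))) ⟩
    ∑ ts (λ a → ∑ (antidiag n) (λ p → δ (size a) (proj₁ p) * sumOver h (proj₂ p) (λ b → f (node a b))))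
      ≡⟨ ∑-swap ts (antidiag n) _ ⟩
    ∑ (antidiag n) (λ p → ∑ ts (λ a → δ (size a) (proj₁ p) * sumOver h (proj₂ p) (λ b → f (node a b))))
      ≡⟨ ∑-cong (antidiag n) (λ p → sym (sumOver-δ h (proj₁ p) _)) ⟩
    ∑ (antidiag n) (λ p → sumOver h (proj₁ p) (λ a → sumOver h (proj₂ p) (λ b → f (node a b)))) ∎
    where
    open ≡-Reasoning
    ts : List Tree
    ts = byHeight h
    split : ∀ a b → δ (size a ℕ.+ size b) n * f (node a b) ≡
      ∑ (antidiag n) (λ p → δ (size a) (proj₁ p) * (δ (size b) (proj₂ p) * f (node a b)))
    split a b = begin
      δ (size a ℕ.+ size b) n * x
        ≡⟨ cong (_* x) (∑-antidiag-δδ (size a) (size b) n) ⟨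
      ∑ (antidiag n) (λ p → δ (size a) (proj₁ p) * δ (size b) (proj₂ p)) * x
        ≡⟨ *-comm _ x ⟩
      x * ∑ (antidiag n) (λ p → δ (size a) (proj₁ p) * δ (size b) (proj₂ p))
        ≡⟨ ∑-*ˡ (antidiag n) x _ ⟨
      ∑ (antidiag n) (λ p → x * (δ (size a) (proj₁ p) * δ (size b) (proj₂ p)))
        ≡⟨ ∑-cong (antidiag n) (λ p → rot x (δ (size a) (proj₁ p)) (δ (size b) (proj₂ p))) ⟩
      ∑ (antidiag n) (λ p → δ (size a) (proj₁ p) * (δ (size b) (proj₂ p) * x)) ∎
      where
      x : K
      x = f (node a b)
      rot : ∀ x y z → x * (y * z) ≡ y * (z * x)
      rot = solve 3 (λ x y z → x :* (y :* z) := y :* (z :* x)) refl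

  -- `byHeight (suc h)` takes both subtrees from `byHeight h` whatever their sizes, so the recursion
  -- yields height bounds that exceed the sizes. Removing this surplus makes `total-suc` a recursion
  -- in the size alone.
  sumOver-stable : ∀ h n f → n ≤ h → sumOver (suc h) n f ≡ sumOver h n f
  sumOver-stable h       zero    f _         = trans (sumOver-zero (suc h) f) (sym (sumOver-zero h f))
  sumOver-stable (suc h) (suc n) f (s≤s n≤h) = begin
    sumOver (suc (suc h)) (suc n) f
      ≡⟨ sumOver-suc (suc h) n f ⟩
    ∑ (antidiag n) (λ p → sumOver (suc h) (proj₁ p) (λ a → sumOver (suc h) (proj₂ p) (λ b → f (node a b))))
      ≡⟨ ∑-cong∈ (antidiag n) (λ {p} p∈ → trans
           (sumOver-stable h (proj₁ p) _ (ℕₚ.≤-trans (∈-antidiag-≤₁ n p∈) n≤h))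
           (∑-cong (filter (λ t → size t ℕ.≟ proj₁ p) (byHeight h)) (λ a →
             sumOver-stable h (proj₂ p) _ (ℕₚ.≤-trans (∈-antidiag-≤₂ n p∈) n≤h)))) ⟩
    ∑ (antidiag n) (λ p → sumOver h (proj₁ p) (λ a → sumOver h (proj₂ p) (λ b → f (node a b))))
      ≡⟨ sumOver-suc h n f ⟨
    sumOver (suc h) (suc n) f ∎
    where open ≡-Reasoning

  total : ℕ → (Tree → K) → K
  total n f = ∑ (treesOfSize n) f

  sumOver≡total : ∀ {h n} f → n ≤ h → sumOver h n f ≡ total n f
  sumOver≡total {h} {n} f n≤h = subst (λ h → sumOver h n f ≡ total n f) (ℕₚ.m∸n+n≡m n≤h) (go (h ℕ.∸ n))
    where
    go : ∀ k → sumOver (k ℕ.+ n) n f ≡ total n f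
    go zero    = refl
    go (suc k) = trans (sumOver-stable (k ℕ.+ n) n f (ℕₚ.m≤n+m n k)) (go k)

  total-suc : ∀ n f →
    total (suc n) f ≡ ∑ (antidiag n) (λ p → total (proj₁ p) (λ a → total (proj₂ p) (λ b → f (node a b))))
  total-suc n f = trans (sumOver-suc n n f)
    (∑-cong∈ (antidiag n) (λ {p} p∈ → trans
      (sumOver≡total _ (∈-antidiag-≤₁ n p∈))
      (∑-cong (treesOfSize (proj₁ p)) (λ a → sumOver≡total _ (∈-antidiag-≤₂ n p∈)))))

  -- Totals over the expansions of a tree

  lift : (Tree → K) → Tree → K
  -- The lone leaf is not an expansion of any tree, although `reduce` sends it to `leaf`, so it gets
  -- weight zero.
  lift f leaf       = 0#
  lift f (node a b) = f (reduce (node a b))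

  leafIndicator : Tree → K
  leafIndicator leaf       = 1#
  leafIndicator (node _ _) = 0#

  -- The summands belong to the four shapes of the root: two leaves, a leaf on the left only, a leaf
  -- on the right only, no leaf. Only the matching summand can be nonzero, as the nested `lift`
  -- vanishes when either subtree is a leaf.
  lift-node : ∀ f a b → lift f (node a b) ≡
    leafIndicator a * (leafIndicator b * f leaf) + leafIndicator a * lift f b + leafIndicator b * lift f a
    + lift (λ s → lift (λ t → f (node s t)) b) a
  lift-node f leaf         leaf         =
    solve 1 (λ x → x := con 1 :* (con 1 :* x) :+ con 1 :* con 0 :+ con 1 :* con 0 :+ con 0) refl (f leaf)
  lift-node f leaf         (node b₁ b₂) =
    solve 2 (λ x y → y := con 1 :* (con 0 :* x) :+ con 1 :* y :+ con 0 :* con 0 :+ con 0) refl (f leaf) _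
  lift-node f (node a₁ a₂) leaf         =
    solve 2 (λ x y → y := con 0 :* (con 1 :* x) :+ con 0 :* con 0 :+ con 1 :* y :+ con 0) refl (f leaf) _
  lift-node f (node a₁ a₂) (node b₁ b₂) =
    solve 4 (λ x y z w → w := con 0 :* (con 0 :* x) :+ con 0 :* y :+ con 0 :* z :+ w) refl
      (f leaf) (f (reduce (node b₁ b₂))) (f (reduce (node a₁ a₂))) _

  total-leafIndicator : ∀ n → total n leafIndicator ≡ δ 0 n
  total-leafIndicator zero    = +-identityʳ 1#
  total-leafIndicator (suc n) = trans (total-suc n leafIndicator)
    (trans (∑-cong (antidiag n) (λ p → trans (∑-cong (treesOfSize (proj₁ p)) (λ a → ∑-0 (treesOfSize (proj₂ p))))
                                             (∑-0 (treesOfSize (proj₁ p)))))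
           (∑-0 (antidiag n)))

  ∑-lift : ∀ {A : Set} (xs : List A) (f : A → Tree → K) t →
    ∑ xs (λ x → lift (f x) t) ≡ lift (λ s → ∑ xs (λ x → f x s)) t
  ∑-lift xs f leaf       = ∑-0 xs
  ∑-lift xs f (node a b) = refl

  ∑-*ʳ : ∀ {A : Set} (xs : List A) y f → ∑ xs (λ x → f x * y) ≡ ∑ xs f * y
  ∑-*ʳ xs y f = trans (∑-cong xs (λ x → *-comm (f x) y)) (trans (∑-*ˡ xs y f) (*-comm y _))

  -- The two equal middle terms come from roots with one leaf child, which `reduce` contracts. The
  -- choice of the side is the origin of the 2 in 1 - 2z.
  total-lift-suc : ∀ n f → total (suc n) (lift f) ≡
    δ 0 n * f leaf + total n (lift f) + total n (lift f)
    + ∑ (antidiag n) (λ p → total (proj₁ p) (lift (λ s → total (proj₂ p) (lift (λ t → f (node s t))))))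
  total-lift-suc n f = begin
    total (suc n) (lift f)
      ≡⟨ total-suc n (lift f) ⟩
    ∑ (antidiag n) (λ p → total (proj₁ p) (λ a → total (proj₂ p) (λ b → lift f (node a b))))
      ≡⟨ ∑-cong (antidiag n) (λ p → split (proj₁ p) (proj₂ p)) ⟩
    ∑ (antidiag n) (λ p → δ 0 (proj₁ p) * (δ 0 (proj₂ p) * f leaf)
      + δ 0 (proj₁ p) * total (proj₂ p) (lift f) + δ 0 (proj₂ p) * total (proj₁ p) (lift f) + rest p)
      ≡⟨ trans (∑-+ (antidiag n) _ rest) (cong (_+ ∑ (antidiag n) rest)
          (trans (∑-+ (antidiag n) _ _) (cong (_+ ∑ (antidiag n) (λ p → δ 0 (proj₂ p) * total (proj₁ p) (lift f)))
            (∑-+ (antidiag n) _ _)))) ⟩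
    ∑ (antidiag n) (λ p → δ 0 (proj₁ p) * (δ 0 (proj₂ p) * f leaf))
      + ∑ (antidiag n) (λ p → δ 0 (proj₁ p) * total (proj₂ p) (lift f))
      + ∑ (antidiag n) (λ p → δ 0 (proj₂ p) * total (proj₁ p) (lift f)) + ∑ (antidiag n) rest
      ≡⟨ cong (_+ ∑ (antidiag n) rest) (cong₂ _+_ (cong₂ _+_
           (∑-antidiag-δˡ n (λ j → δ 0 j * f leaf)) (∑-antidiag-δˡ n (λ j → total j (lift f))))
           (∑-antidiag-δʳ n (λ i → total i (lift f)))) ⟩
    δ 0 n * f leaf + total n (lift f) + total n (lift f) + ∑ (antidiag n) rest ∎
    where
    open ≡-Reasoning
    rest : ℕ × ℕ → K
    rest p = total (proj₁ p) (lift (λ s → total (proj₂ p) (lift (λ t → f (node s t)))))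
    inner : ∀ j a → total j (λ b → lift f (node a b)) ≡
      leafIndicator a * (δ 0 j * f leaf) + leafIndicator a * total j (lift f) + δ 0 j * lift f a
      + lift (λ s → total j (lift (λ t → f (node s t)))) a
    inner j a = begin
      ∑ ts (λ b → lift f (node a b))
        ≡⟨ ∑-cong ts (lift-node f a) ⟩
      ∑ ts (λ b → x * (leafIndicator b * f leaf) + x * lift f b + leafIndicator b * lift f a + both b)
        ≡⟨ trans (∑-+ ts _ both) (cong (_+ ∑ ts both)
             (trans (∑-+ ts _ _) (cong (_+ ∑ ts (λ b → leafIndicator b * lift f a)) (∑-+ ts _ _)))) ⟩
      ∑ ts (λ b → x * (leafIndicator b * f leaf)) + ∑ ts (λ b → x * lift f b)
        + ∑ ts (λ b → leafIndicator b * lift f a) + ∑ ts both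
        ≡⟨ cong₂ _+_ (cong₂ _+_ (cong₂ _+_
             (trans (∑-*ˡ ts x _) (cong (x *_) (leaves (f leaf))))
             (∑-*ˡ ts x (lift f)))
             (leaves (lift f a)))
             (∑-lift-both a) ⟩
      x * (δ 0 j * f leaf) + x * total j (lift f) + δ 0 j * lift f a
        + lift (λ s → total j (lift (λ t → f (node s t)))) a ∎
      where
      ts : List Tree
      ts = treesOfSize j
      x : K
      x = leafIndicator a
      both : Tree → K
      both b = lift (λ s → lift (λ t → f (node s t)) b) a
      leaves : ∀ y → ∑ ts (λ b → leafIndicator b * y) ≡ δ 0 j * y
      leaves y = trans (∑-*ʳ ts y leafIndicator) (cong (_* y) (total-leafIndicator j))
      ∑-lift-both : ∀ a → ∑ ts (λ b → lift (λ s → lift (λ t → f (node s t)) b) a) ≡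
        lift (λ s → total j (lift (λ t → f (node s t)))) a
      ∑-lift-both a = ∑-lift ts (λ b s → lift (λ t → f (node s t)) b) a
    split : ∀ i j → total i (λ a → total j (λ b → lift f (node a b))) ≡
      δ 0 i * (δ 0 j * f leaf) + δ 0 i * total j (lift f) + δ 0 j * total i (lift f)
      + total i (lift (λ s → total j (lift (λ t → f (node s t)))))
    split i j = begin
      ∑ ts (λ a → total j (λ b → lift f (node a b)))
        ≡⟨ ∑-cong ts (inner j) ⟩
      ∑ ts (λ a → leafIndicator a * (δ 0 j * f leaf) + leafIndicator a * total j (lift f) + δ 0 j * lift f a + both a)
        ≡⟨ trans (∑-+ ts _ both) (cong (_+ ∑ ts both)
             (trans (∑-+ ts _ _) (cong (_+ ∑ ts (λ a → δ 0 j * lift f a)) (∑-+ ts _ _)))) ⟩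
      ∑ ts (λ a → leafIndicator a * (δ 0 j * f leaf)) + ∑ ts (λ a → leafIndicator a * total j (lift f))
        + ∑ ts (λ a → δ 0 j * lift f a) + ∑ ts both
        ≡⟨ cong (_+ ∑ ts both) (cong₂ _+_ (cong₂ _+_ (leaves _) (leaves _)) (∑-*ˡ ts (δ 0 j) (lift f))) ⟩
      δ 0 i * (δ 0 j * f leaf) + δ 0 i * total j (lift f) + δ 0 j * total i (lift f) + ∑ ts both ∎
      where
      ts : List Tree
      ts = treesOfSize i
      both : Tree → K
      both = lift (λ s → total j (lift (λ t → f (node s t))))
      leaves : ∀ y → ∑ ts (λ b → leafIndicator b * y) ≡ δ 0 i * y
      leaves y = trans (∑-*ʳ ts y leafIndicator) (cong (_* y) (total-leafIndicator i))

  -- Expanding a tree s of size k to all t with reduce t = s contributes (z / (1 - 2z))²ᵏ⁺¹.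
  total-lift-byHeight : ∀ h n → n ≤ h → ∀ f →
    total n (lift f) ≡ ∑ (byHeight h) (λ s → coeff (suc (size s ℕ.+ size s)) n * f s)
  total-lift-byHeight h zero _ f = trans (+-identityʳ 0#)
    (sym (trans (∑-cong (byHeight h) (λ s → zeroˡ (f s))) (∑-0 (byHeight h))))
  total-lift-byHeight (suc h) (suc n) (s≤s n≤h) f = begin
    total (suc n) (lift f)
      ≡⟨ total-lift-suc n f ⟩
    δ 0 n * f leaf + total n (lift f) + total n (lift f)
      + ∑ (antidiag n) (λ p → total (proj₁ p) (lift (λ s → total (proj₂ p) (lift (λ t → f (node s t))))))
      ≡⟨ cong₂ (λ x y → δ 0 n * f leaf + x + x + y)
           (trans (total-lift-byHeight (suc h) n (ℕₚ.m≤n⇒m≤1+n n≤h) f) (∑-byHeight-suc h (λ s → w s n * f s)))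
           double ⟩
    δ 0 n * f leaf + (w leaf n * f leaf + Q) + (w leaf n * f leaf + Q) + P
      ≡⟨ solve 5 (λ d l q p x → d :* x :+ (l :* x :+ q) :+ (l :* x :+ q) :+ p :=
           (d :+ (con 1 :+ con 1) :* l) :* x :+ (p :+ (con 1 :+ con 1) :* q)) refl (δ 0 n) (w leaf n) Q P (f leaf) ⟩
    w leaf (suc n) * f leaf + (P + 2# * Q)
      ≡⟨ cong (w leaf (suc n) * f leaf +_) combine ⟨
    w leaf (suc n) * f leaf + ∑ ts (λ a → ∑ ts (λ b → w (node a b) (suc n) * f (node a b)))
      ≡⟨ ∑-byHeight-suc h (λ s → w s (suc n) * f s) ⟨
    ∑ (byHeight (suc h)) (λ s → w s (suc n) * f s) ∎
    where
    open ≡-Reasoning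
    ts : List Tree
    ts = byHeight h
    w : Tree → ℕ → K
    w s m = coeff (suc (size s ℕ.+ size s)) m
    Q P : K
    Q = ∑ ts (λ a → ∑ ts (λ b → w (node a b) n * f (node a b)))
    P = ∑ ts (λ a → ∑ ts (λ b → coeff (suc (size a ℕ.+ size a) ℕ.+ suc (size b ℕ.+ size b)) n * f (node a b)))
    double : ∑ (antidiag n) (λ p → total (proj₁ p) (lift (λ s → total (proj₂ p) (lift (λ t → f (node s t)))))) ≡ P
    double = begin
      ∑ (antidiag n) (λ p → total (proj₁ p) (lift (λ s → total (proj₂ p) (lift (λ t → f (node s t))))))
        ≡⟨ ∑-cong∈ (antidiag n) (λ {p} p∈ → trans
             (total-lift-byHeight h (proj₁ p) (ℕₚ.≤-trans (∈-antidiag-≤₁ n p∈) n≤h) _)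
             (∑-cong ts (λ a → trans
               (cong (w a (proj₁ p) *_)
                 (total-lift-byHeight h (proj₂ p) (ℕₚ.≤-trans (∈-antidiag-≤₂ n p∈) n≤h) _))
               (sym (∑-*ˡ ts (w a (proj₁ p)) _))))) ⟩
      ∑ (antidiag n) (λ p → ∑ ts (λ a → ∑ ts (λ b → w a (proj₁ p) * (w b (proj₂ p) * f (node a b)))))
        ≡⟨ ∑-swap (antidiag n) ts _ ⟩
      ∑ ts (λ a → ∑ (antidiag n) (λ p → ∑ ts (λ b → w a (proj₁ p) * (w b (proj₂ p) * f (node a b)))))
        ≡⟨ ∑-cong ts (λ a → ∑-swap (antidiag n) ts _) ⟩
      ∑ ts (λ a → ∑ ts (λ b → ∑ (antidiag n) (λ p → w a (proj₁ p) * (w b (proj₂ p) * f (node a b)))))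
        ≡⟨ ∑-cong ts (λ a → ∑-cong ts (λ b → trans
             (∑-cong (antidiag n) (λ p → sym (*-assoc (w a (proj₁ p)) (w b (proj₂ p)) (f (node a b)))))
             (trans (∑-*ʳ (antidiag n) (f (node a b)) (λ p → w a (proj₁ p) * w b (proj₂ p)))
               (cong (_* f (node a b))
                 (coeff-convolution (suc (size a ℕ.+ size a)) (suc (size b ℕ.+ size b)) n))))) ⟩
      P ∎
    combine : ∑ ts (λ a → ∑ ts (λ b → w (node a b) (suc n) * f (node a b))) ≡ P + 2# * Q
    combine = begin
      ∑ ts (λ a → ∑ ts (λ b → w (node a b) (suc n) * f (node a b)))
        ≡⟨ ∑-cong ts (λ a → trans (∑-cong ts (λ b → expand a b)) (trans (∑-+ ts _ _)
             (cong (∑ ts (λ b → u a b * f (node a b)) +_) (∑-*ˡ ts 2# _)))) ⟩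
      ∑ ts (λ a → ∑ ts (λ b → u a b * f (node a b)) + 2# * ∑ ts (λ b → w (node a b) n * f (node a b)))
        ≡⟨ trans (∑-+ ts _ _) (cong (P +_) (∑-*ˡ ts 2# _)) ⟩
      P + 2# * Q ∎
      where
      u : Tree → Tree → K
      u a b = coeff (suc (size a ℕ.+ size a) ℕ.+ suc (size b ℕ.+ size b)) n
      -- Expanding the two subtrees supplies (2x+1) + (2y+1) factors z/(1 - 2z). The one further
      -- factor in `w (node a b)` stands for the kept root together with the chain of contracted
      -- nodes above it.
      exponent : ∀ x y → suc (x ℕ.+ y) ℕ.+ suc (x ℕ.+ y) ≡ suc (x ℕ.+ x) ℕ.+ suc (y ℕ.+ y)
      exponent = ℕ-solve-∀
      expand : ∀ a b → w (node a b) (suc n) * f (node a b) ≡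
        u a b * f (node a b) + 2# * (w (node a b) n * f (node a b))
      expand a b = trans
        (cong (λ e → (coeff e n + 2# * w (node a b) n) * f (node a b)) (exponent (size a) (size b)))
        (solve 4 (λ t x y z → (x :+ t :* y) :* z := x :* z :+ t :* (y :* z)) refl 2# (u a b) (w (node a b) n) (f (node a b)))

  -- The operator `L` on sequences

  ∑-upTo-suc : ∀ n f → ∑ (upTo (suc n)) f ≡ f 0 + ∑ (upTo n) (f ∘ suc)
  ∑-upTo-suc n f = cong (f 0 +_)
    (trans (cong (λ xs → ∑ xs f) (sym (map-upTo suc n))) (∑-map suc (upTo n) f))

  ∑-upTo-vanish : ∀ n f → (∀ k → f k ≡ 0#) → ∑ (upTo n) f ≡ 0#
  ∑-upTo-vanish n f f≡0 = trans (∑-cong (upTo n) f≡0) (∑-0 (upTo n))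

  ∑-upTo-extend : ∀ {m n} f → m ≤ n → (∀ k → m ≤ k → f k ≡ 0#) → ∑ (upTo n) f ≡ ∑ (upTo m) f
  ∑-upTo-extend {zero}  {n}     f _         f≡0 = ∑-upTo-vanish n f (λ k → f≡0 k z≤n)
  ∑-upTo-extend {suc m} {suc n} f (s≤s m≤n) f≡0 = begin
    ∑ (upTo (suc n)) f              ≡⟨ ∑-upTo-suc n f ⟩
    f 0 + ∑ (upTo n) (f ∘ suc)      ≡⟨ cong (f 0 +_) (∑-upTo-extend (f ∘ suc) m≤n (λ k m≤k → f≡0 (suc k) (s≤s m≤k))) ⟩
    f 0 + ∑ (upTo m) (f ∘ suc)      ≡⟨ ∑-upTo-suc m f ⟨
    ∑ (upTo (suc m)) f              ∎
    where open ≡-Reasoning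

  ∑-upTo-δ : ∀ m n (w : ℕ → K) → (∀ k → n ≤ k → w k ≡ 0#) → ∑ (upTo n) (λ k → w k * δ m k) ≡ w m
  ∑-upTo-δ m       zero    w w≡0 = sym (w≡0 m z≤n)
  ∑-upTo-δ zero    (suc n) w w≡0 = begin
    ∑ (upTo (suc n)) (λ k → w k * δ 0 k)            ≡⟨ ∑-upTo-suc n (λ k → w k * δ 0 k) ⟩
    w 0 * 1# + ∑ (upTo n) (λ k → w (suc k) * 0#)    ≡⟨ cong₂ _+_ (*-identityʳ (w 0)) (∑-upTo-vanish n _ (λ k → zeroʳ (w (suc k)))) ⟩
    w 0 + 0#                                        ≡⟨ +-identityʳ (w 0) ⟩
    w 0                                             ∎
    where open ≡-Reasoning
  ∑-upTo-δ (suc m) (suc n) w w≡0 = begin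
    ∑ (upTo (suc n)) (λ k → w k * δ (suc m) k)         ≡⟨ ∑-upTo-suc n (λ k → w k * δ (suc m) k) ⟩
    w 0 * 0# + ∑ (upTo n) (λ k → w (suc k) * δ m k)    ≡⟨ cancel-zeroˡ (zeroʳ (w 0)) ⟩
    ∑ (upTo n) (λ k → w (suc k) * δ m k)               ≡⟨ ∑-upTo-δ m n (w ∘ suc) (λ k n≤k → w≡0 (suc k) (s≤s n≤k)) ⟩
    w (suc m)                                          ∎
    where open ≡-Reasoning

  -- Expansions have at least one inner node, so index n after applying `L` stands for size n + 1;
  -- hence `suc n`. The weight is binom(n, 2k) 2ⁿ⁻²ᵏ.
  oddWeight : ℕ → ℕ → K
  oddWeight n k = coeff (suc (k ℕ.+ k)) (suc n)

  oddWeight-vanishes : ∀ {n k} → suc n ≤ k → oddWeight n k ≡ 0#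
  oddWeight-vanishes {n} {k} n<k = coeff-vanishes {suc (k ℕ.+ k)} (s≤s (ℕₚ.≤-trans n<k (ℕₚ.m≤m+n k k)))

  -- On generating functions, L sends A(z) to A(z² / (1 - 2z)²) / (1 - 2z).
  L : (ℕ → K) → ℕ → K
  L A n = ∑ (upTo (suc n)) (λ k → oddWeight n k * A k)

  total-lift : ∀ n f → total (suc n) (lift f) ≡ L (λ k → total k f) n
  total-lift n f = begin
    total (suc n) (lift f)
      ≡⟨ total-lift-byHeight (suc n) (suc n) ℕₚ.≤-refl f ⟩
    ∑ ts (λ s → oddWeight n (size s) * f s)
      ≡⟨ ∑-cong ts (λ s → cong (_* f s) (∑-upTo-δ (size s) (suc n) (oddWeight n) (λ k → oddWeight-vanishes))) ⟨
    ∑ ts (λ s → ∑ (upTo (suc n)) (λ k → oddWeight n k * δ (size s) k) * f s)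
      ≡⟨ ∑-cong ts (λ s → trans (sym (∑-*ʳ (upTo (suc n)) (f s) _))
           (∑-cong (upTo (suc n)) (λ k → *-assoc (oddWeight n k) (δ (size s) k) (f s)))) ⟩
    ∑ ts (λ s → ∑ (upTo (suc n)) (λ k → oddWeight n k * (δ (size s) k * f s)))
      ≡⟨ ∑-swap ts (upTo (suc n)) _ ⟩
    ∑ (upTo (suc n)) (λ k → ∑ ts (λ s → oddWeight n k * (δ (size s) k * f s)))
      ≡⟨ ∑-cong∈ (upTo (suc n)) (λ {k} k∈ → trans (∑-*ˡ ts (oddWeight n k) _) (cong (oddWeight n k *_)
           (trans (sym (sumOver-δ (suc n) k f)) (sumOver≡total f (ℕₚ.<⇒≤ (∈-upTo⁻ k∈)))))) ⟩
    L (λ k → total k f) n ∎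
    where
    open ≡-Reasoning
    ts : List Tree
    ts = byHeight (suc n)

  L-wide : ∀ A {n N} → suc n ≤ N → L A n ≡ ∑ (upTo N) (λ k → oddWeight n k * A k)
  L-wide A {n} n<N = sym (∑-upTo-extend _ n<N
    (λ k n<k → trans (cong (_* A k) (oddWeight-vanishes n<k)) (zeroˡ (A k))))

  -- For T = z/(1 - 2z) one has T⁻² = z⁻² - 4z⁻¹ + 4. This is T²ᵏ⁺³T⁻² = T²ᵏ⁺¹ read off
  -- coefficientwise, with the negative term moved across because `K` is a semiring.
  oddWeight-shift : ∀ n k →
    oddWeight (suc (suc n)) (suc k) + 4# * oddWeight n (suc k) ≡ oddWeight n k + 4# * oddWeight (suc n) (suc k)
  oddWeight-shift n k rewrite ℕₚ.+-suc k k = solve 3 (λ x y z →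
    let two = con 1 :+ con 1 ; four = two :+ two in
    x :+ two :* y :+ two :* (y :+ two :* z) :+ four :* z := x :+ four :* (y :+ two :* z))
    refl (coeff (suc (k ℕ.+ k)) (suc n)) (coeff (suc (suc (k ℕ.+ k))) (suc n)) (coeff (suc (suc (suc (k ℕ.+ k)))) (suc n))

  -- This is `oddWeight-shift` summed against `A`. The values of `L A` at n, n + 1 and n + 2 are
  -- first brought to a common range of summation by `L-wide`.
  L-shift : ∀ A n → L A (suc (suc n)) + 4# * L A n ≡ L (A ∘ suc) n + 4# * L A (suc n)
  L-shift A n = begin
    L A (suc (suc n)) + 4# * L A n
      ≡⟨ cong₂ (λ x y → x + 4# * y) (wide (suc (suc n)) ℕₚ.≤-refl) (wide n (s≤s (ℕₚ.m≤n⇒m≤1+n (ℕₚ.n≤1+n n)))) ⟩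
    oddWeight (suc (suc n)) 0 * A 0 + tail (suc (suc n)) + 4# * (oddWeight n 0 * A 0 + tail n)
      ≡⟨ solve 6 (λ a x y z w f → a :* z :+ x :+ f :* (w :* z :+ y) := (a :+ f :* w) :* z :+ (x :+ f :* y)) refl
           (oddWeight (suc (suc n)) 0) (tail (suc (suc n))) (tail n) (A 0) (oddWeight n 0) 4# ⟩
    (oddWeight (suc (suc n)) 0 + 4# * oddWeight n 0) * A 0 + (tail (suc (suc n)) + 4# * tail n)
      ≡⟨ cong₂ (λ x y → x * A 0 + y) first rest ⟩
    4# * oddWeight (suc n) 0 * A 0 + (L (A ∘ suc) n + 4# * tail (suc n))
      ≡⟨ solve 5 (λ f w a x y → f :* w :* a :+ (x :+ f :* y) := x :+ f :* (w :* a :+ y)) refl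
           4# (oddWeight (suc n) 0) (A 0) (L (A ∘ suc) n) (tail (suc n)) ⟩
    L (A ∘ suc) n + 4# * (oddWeight (suc n) 0 * A 0 + tail (suc n))
      ≡⟨ cong (λ x → L (A ∘ suc) n + 4# * x) (wide (suc n) (s≤s (s≤s (ℕₚ.n≤1+n n)))) ⟨
    L (A ∘ suc) n + 4# * L A (suc n) ∎
    where
    open ≡-Reasoning
    ks : List ℕ
    ks = upTo (suc (suc n))
    tail : ℕ → K
    tail m = ∑ ks (λ k → oddWeight m (suc k) * A (suc k))
    wide : ∀ m → suc m ≤ suc (suc (suc n)) → L A m ≡ oddWeight m 0 * A 0 + tail m
    wide m m<N = trans (L-wide A m<N) (∑-upTo-suc (suc (suc n)) (λ k → oddWeight m k * A k))
    -- The term k = 0 has no predecessor on the other side: T · T⁻² = z⁻¹ - 2 has no coefficients in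
    -- positive degrees.
    first : oddWeight (suc (suc n)) 0 + 4# * oddWeight n 0 ≡ 4# * oddWeight (suc n) 0
    first = solve 1 (λ z → let two = con 1 :+ con 1 ; four = two :+ two in
      con 0 :+ two :* (con 0 :+ two :* z) :+ four :* z := four :* (con 0 :+ two :* z)) refl (oddWeight n 0)
    rest : tail (suc (suc n)) + 4# * tail n ≡ L (A ∘ suc) n + 4# * tail (suc n)
    rest = begin
      tail (suc (suc n)) + 4# * tail n
        ≡⟨ merge (oddWeight (suc (suc n)) ∘ suc) (oddWeight n ∘ suc) ⟨
      ∑ ks (λ k → (oddWeight (suc (suc n)) (suc k) + 4# * oddWeight n (suc k)) * A (suc k))
        ≡⟨ ∑-cong ks (λ k → cong (_* A (suc k)) (oddWeight-shift n k)) ⟩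
      ∑ ks (λ k → (oddWeight n k + 4# * oddWeight (suc n) (suc k)) * A (suc k))
        ≡⟨ merge (oddWeight n) (oddWeight (suc n) ∘ suc) ⟩
      ∑ ks (λ k → oddWeight n k * A (suc k)) + 4# * tail (suc n)
        ≡⟨ cong (_+ 4# * tail (suc n)) (L-wide (A ∘ suc) (ℕₚ.n≤1+n (suc n))) ⟨
      L (A ∘ suc) n + 4# * tail (suc n) ∎
      where
      merge : ∀ (u v : ℕ → K) → ∑ ks (λ k → (u k + 4# * v k) * A (suc k)) ≡
        ∑ ks (λ k → u k * A (suc k)) + 4# * ∑ ks (λ k → v k * A (suc k))
      merge u v = trans
        (∑-cong ks (λ k → solve 4 (λ x y z f → (x :+ f :* y) :* z := x :* z :+ f :* (y :* z)) refl (u k) (v k) (A (suc k)) 4#))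
        (trans (∑-+ ks _ _) (cong (∑ ks (λ k → u k * A (suc k)) +_) (∑-*ˡ ks 4# _)))

  -- The Catalan numbers

  ι : ℕ → K
  ι zero    = 0#
  ι (suc n) = 1# + ι n

  catalan : ℕ → K
  catalan n = total n (λ _ → 1#)

  catalan-suc : ∀ n → catalan (suc n) ≡ ∑ (antidiag n) (λ p → catalan (proj₁ p) * catalan (proj₂ p))
  catalan-suc n = trans (total-suc n (λ _ → 1#)) (∑-cong (antidiag n) (λ p →
    trans (∑-cong (treesOfSize (proj₁ p)) (λ _ → sym (*-identityˡ _)))
          (∑-*ʳ (treesOfSize (proj₁ p)) _ (λ _ → 1#))))

  ι-+ : ∀ m n → ι (m ℕ.+ n) ≡ ι m + ι n
  ι-+ zero    n = sym (+-identityˡ (ι n))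
  ι-+ (suc m) n = trans (cong (1# +_) (ι-+ m n)) (sym (+-assoc 1# (ι m) (ι n)))

  ∑-catalan-symmetrize : ∀ n (g : ℕ → K) →
    2# * ∑ (antidiag n) (λ p → g (proj₁ p) * (catalan (proj₁ p) * catalan (proj₂ p))) ≡
    ∑ (antidiag n) (λ p → (g (proj₁ p) + g (proj₂ p)) * (catalan (proj₁ p) * catalan (proj₂ p)))
  ∑-catalan-symmetrize n g = begin
    2# * ∑ ps (λ p → g (proj₁ p) * w p)
      ≡⟨ solve 1 (λ x → (con 1 :+ con 1) :* x := x :+ x) refl _ ⟩
    ∑ ps (λ p → g (proj₁ p) * w p) + ∑ ps (λ p → g (proj₁ p) * w p)
      ≡⟨ cong (∑ ps (λ p → g (proj₁ p) * w p) +_) (∑-antidiag-swap n (λ p → g (proj₁ p) * w p)) ⟩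
    ∑ ps (λ p → g (proj₁ p) * w p) + ∑ ps (λ p → g (proj₂ p) * (catalan (proj₂ p) * catalan (proj₁ p)))
      ≡⟨ ∑-+ ps _ _ ⟨
    ∑ ps (λ p → g (proj₁ p) * w p + g (proj₂ p) * (catalan (proj₂ p) * catalan (proj₁ p)))
      ≡⟨ ∑-cong ps (λ p → solve 4 (λ x y u v → x :* (u :* v) :+ y :* (v :* u) := (x :+ y) :* (u :* v)) refl
           (g (proj₁ p)) (g (proj₂ p)) (catalan (proj₁ p)) (catalan (proj₂ p))) ⟩
    ∑ ps (λ p → (g (proj₁ p) + g (proj₂ p)) * w p) ∎
    where
    open ≡-Reasoning
    ps : List (ℕ × ℕ)
    ps = antidiag n
    w : ℕ × ℕ → K
    w p = catalan (proj₁ p) * catalan (proj₂ p)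

  -- A linear weight and its reflection add up to a constant on i + j = n, which leaves the plain
  -- Catalan recursion. `catalan-ratio` uses the weights i + 1 and 4i + 2.
  ∑-catalan-constant : ∀ n (g : ℕ → K) x → (∀ i j → i ℕ.+ j ≡ n → g i + g j ≡ x) →
    2# * ∑ (antidiag n) (λ p → g (proj₁ p) * (catalan (proj₁ p) * catalan (proj₂ p))) ≡ x * catalan (suc n)
  ∑-catalan-constant n g x g+g≡x = begin
    2# * ∑ (antidiag n) (λ p → g (proj₁ p) * (catalan (proj₁ p) * catalan (proj₂ p)))
      ≡⟨ ∑-catalan-symmetrize n g ⟩
    ∑ (antidiag n) (λ p → (g (proj₁ p) + g (proj₂ p)) * (catalan (proj₁ p) * catalan (proj₂ p)))
      ≡⟨ ∑-cong∈ (antidiag n) (λ {p} p∈ → cong (_* _) (g+g≡x (proj₁ p) (proj₂ p) (∈-antidiag n p∈))) ⟩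
    ∑ (antidiag n) (λ p → x * (catalan (proj₁ p) * catalan (proj₂ p)))
      ≡⟨ ∑-*ˡ (antidiag n) x _ ⟩
    x * ∑ (antidiag n) (λ p → catalan (proj₁ p) * catalan (proj₂ p))
      ≡⟨ cong (x *_) (catalan-suc n) ⟨
    x * catalan (suc n) ∎
    where open ≡-Reasoning

  -- Both sides of the recursion at n + 1 are evaluations of 2 ∑ (i + 1) Cᵢ Cⱼ over i + j = n + 1:
  -- by symmetry, and by lowering i with the recursion at i ≤ n.
  catalan-ratio : ∀ n → ι (suc (suc n)) * catalan (suc n) ≡ (4# * ι n + 2#) * catalan n
  catalan-ratio n = go n n ℕₚ.≤-refl
    where
    open ≡-Reasoning
    go : ∀ N n → n ≤ N → ι (suc (suc n)) * catalan (suc n) ≡ (4# * ι n + 2#) * catalan n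
    go N       zero    _         = solve 0
      ((con 1 :+ (con 1 :+ con 0)) :* (con 1 :+ con 0) :=
       ((con 1 :+ con 1 :+ (con 1 :+ con 1)) :* con 0 :+ (con 1 :+ con 1)) :* (con 1 :+ con 0)) refl
    go (suc N) (suc n) (s≤s n≤N) = begin
      ι (suc (suc (suc n))) * catalan (suc (suc n))
        ≡⟨ ∑-catalan-constant (suc n) (ι ∘ suc) _ (λ i j i+j≡ → trans
             (solve 2 (λ x y → con 1 :+ x :+ (con 1 :+ y) := con 1 :+ (con 1 :+ (x :+ y))) refl (ι i) (ι j))
             (cong (λ x → 1# + (1# + x)) (trans (sym (ι-+ i j)) (cong ι i+j≡)))) ⟨
      2# * ∑ (antidiag (suc n)) (λ p → ι (suc (proj₁ p)) * w p)
        ≡⟨ cong (2# *_) (antidiag-suc n (λ p → ι (suc (proj₁ p)) * w p)) ⟩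
      2# * (ι 1 * (catalan 0 * catalan (suc n)) + ∑ (antidiag n) (λ p → ι (suc (suc (proj₁ p))) * (catalan (suc (proj₁ p)) * catalan (proj₂ p))))
        ≡⟨ cong (λ x → 2# * (ι 1 * (catalan 0 * catalan (suc n)) + x)) (∑-cong∈ (antidiag n) (λ {p} p∈ → trans
             (sym (*-assoc (ι (suc (suc (proj₁ p)))) (catalan (suc (proj₁ p))) (catalan (proj₂ p))))
             (trans (cong (_* catalan (proj₂ p)) (go N (proj₁ p) (ℕₚ.≤-trans (∈-antidiag-≤₁ n p∈) n≤N)))
                    (*-assoc (4# * ι (proj₁ p) + 2#) (catalan (proj₁ p)) (catalan (proj₂ p)))))) ⟩
      2# * (ι 1 * (catalan 0 * catalan (suc n)) + ∑ (antidiag n) (λ p → (4# * ι (proj₁ p) + 2#) * w p))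
        ≡⟨ trans (distribˡ 2# _ _) (cong (2# * (ι 1 * (catalan 0 * catalan (suc n))) +_)
             (∑-catalan-constant n (λ i → 4# * ι i + 2#) (4# * ι n + 4#) (λ i j i+j≡ → trans
               (solve 4 (λ f x y t → f :* x :+ t :+ (f :* y :+ t) := f :* (x :+ y) :+ (t :+ t)) refl 4# (ι i) (ι j) 2#)
               (cong (λ x → 4# * x + 4#) (trans (sym (ι-+ i j)) (cong ι i+j≡)))))) ⟩
      2# * (ι 1 * (catalan 0 * catalan (suc n))) + (4# * ι n + 4#) * catalan (suc n)
        ≡⟨ solve 2 (λ x y → let two = con 1 :+ con 1 ; four = two :+ two in
             two :* ((con 1 :+ con 0) :* ((con 1 :+ con 0) :* y)) :+ (four :* x :+ four) :* y :=
             (four :* (con 1 :+ x) :+ two) :* y) refl (ι n) (catalan (suc n)) ⟩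
      (4# * ι (suc n) + 2#) * catalan (suc n) ∎
      where
      w : ℕ × ℕ → K
      w p = catalan (proj₁ p) * catalan (proj₂ p)

  -- Linearity of `L` and its action on moments

  L-+ : ∀ A B n → L (λ k → A k + B k) n ≡ L A n + L B n
  L-+ A B n = trans (∑-cong (upTo (suc n)) (λ k → distribˡ (oddWeight n k) (A k) (B k))) (∑-+ (upTo (suc n)) _ _)

  L-*ˡ : ∀ y A n → L (λ k → y * A k) n ≡ y * L A n
  L-*ˡ y A n = trans
    (∑-cong (upTo (suc n)) (λ k → solve 3 (λ w y a → w :* (y :* a) := y :* (w :* a)) refl (oddWeight n k) y (A k)))
    (∑-*ˡ (upTo (suc n)) y _)

  L-cong : ∀ {A B} → (∀ k → A k ≡ B k) → ∀ n → L A n ≡ L B n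
  L-cong A≗B n = ∑-cong (upTo (suc n)) (λ k → cong (oddWeight n k *_) (A≗B k))

  -- Every tree with an inner node is an expansion of exactly one tree. With the weights written as
  -- binomial coefficients, this is Touchard's identity.
  L-catalan : ∀ n → L catalan n ≡ catalan (suc n)
  L-catalan n = trans (sym (total-lift n (λ _ → 1#)))
    (trans (total-suc n (lift (λ _ → 1#))) (sym (total-suc n (λ _ → 1#))))

  moment : (ℕ → K) → ℕ → ℕ → K
  moment φ r n = total n (λ t → φ (branches r t))

  -- `branches-reduce` speaks of inner nodes, so the total is opened into nodes by `total-suc` and
  -- closed again; size 0 stays outside.
  moment-suc : ∀ φ r n → moment φ (suc r) (suc n) ≡ L (moment φ r) n
  moment-suc φ r n = begin
    total (suc n) (λ t → φ (branches (suc r) t))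
      ≡⟨ total-suc n (λ t → φ (branches (suc r) t)) ⟩
    ∑ (antidiag n) (λ p → total (proj₁ p) (λ a → total (proj₂ p) (λ b → φ (branches (suc r) (node a b)))))
      ≡⟨ ∑-cong (antidiag n) (λ p → ∑-cong (treesOfSize (proj₁ p)) (λ a → ∑-cong (treesOfSize (proj₂ p)) (λ b →
           cong φ (branches-reduce r a b)))) ⟩
    ∑ (antidiag n) (λ p → total (proj₁ p) (λ a → total (proj₂ p) (λ b → lift (φ ∘ branches r) (node a b))))
      ≡⟨ total-suc n (lift (φ ∘ branches r)) ⟨
    total (suc n) (lift (φ ∘ branches r))
      ≡⟨ total-lift n (φ ∘ branches r) ⟩
    L (moment φ r) n ∎
    where open ≡-Reasoning

  moment-zero : ∀ φ n → moment φ 0 n ≡ φ (suc n) * catalan n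
  moment-zero φ n = begin
    total n (λ t → φ (branches 0 t))
      ≡⟨ ∑-cong∈ (treesOfSize n) (λ {t} t∈ → trans
           (cong φ (trans (branches-zero t) (cong suc (proj₂ (∈-filter⁻ (λ t → size t ℕ.≟ n) {xs = byHeight n} t∈)))))
           (sym (*-identityʳ _))) ⟩
    total n (λ t → φ (suc n) * 1#)
      ≡⟨ ∑-*ˡ (treesOfSize n) (φ (suc n)) (λ _ → 1#) ⟩
    φ (suc n) * catalan n ∎
    where open ≡-Reasoning

-- Bounded sequences of rationals

open import Data.Rational renaming (_≤_ to _≤ℚ_)
open import Data.Rational.Properties
open import Data.Rational.Solver using (module +-*-Solver)
import Data.Rational.Unnormalised as ℚᵘ
import Data.Rational.Unnormalised.Properties as ℚᵘₚ
open +-*-Solver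

ℚring : AlmostCommutativeRing _ _
ℚring = fromCommutativeRing +-*-commutativeRing (λ x → dec⇒maybe (0ℚ ≟ x))

*-monoˡ-0≤ : ∀ {r p q} → 0ℚ ≤ℚ r → p ≤ℚ q → r * p ≤ℚ r * q
*-monoˡ-0≤ {r} 0≤r = *-monoˡ-≤-nonNeg r {{nonNegative 0≤r}}

*-monoʳ-0≤ : ∀ {r p q} → 0ℚ ≤ℚ r → p ≤ℚ q → p * r ≤ℚ q * r
*-monoʳ-0≤ {r} 0≤r = *-monoʳ-≤-nonNeg r {{nonNegative 0≤r}}

*-mono-0≤ : ∀ {p q r s} → 0ℚ ≤ℚ p → p ≤ℚ q → 0ℚ ≤ℚ r → r ≤ℚ s → p * r ≤ℚ q * s
*-mono-0≤ {p} {q} {r} {s} 0≤p p≤q 0≤r r≤s =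
  ≤-trans (*-monoʳ-0≤ {r} {p} {q} 0≤r p≤q) (*-monoˡ-0≤ {q} {r} {s} (≤-trans 0≤p p≤q) r≤s)

0≤*0≤ : ∀ {p q} → 0ℚ ≤ℚ p → 0ℚ ≤ℚ q → 0ℚ ≤ℚ p * q
0≤*0≤ {p} {q} 0≤p 0≤q = subst (_≤ℚ p * q) (*-zeroʳ p) (*-monoˡ-0≤ {p} {0ℚ} {q} 0≤p 0≤q)

0<*0< : ∀ {p q} → 0ℚ < p → 0ℚ < q → 0ℚ < p * q
0<*0< {p} {q} 0<p 0<q = positive⁻¹ (p * q) {{pos*pos⇒pos p {{positive 0<p}} q {{positive 0<q}}}}

0<-cancelˡ : ∀ {p q} → 0ℚ < p → 0ℚ < p * q → 0ℚ < q
0<-cancelˡ {p} {q} 0<p 0<pq =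
  *-cancelˡ-<-nonNeg p {{nonNegative (<⇒≤ 0<p)}} (subst (_< p * q) (sym (*-zeroʳ p)) 0<pq)

p-q≤p : ∀ {p q} → 0ℚ ≤ℚ q → p - q ≤ℚ p
p-q≤p {p} {q} 0≤q = subst (p - q ≤ℚ_) (+-identityʳ p) (+-monoʳ-≤ p (neg-antimono-≤ 0≤q))

-- The bound holds from index 0 on and not just eventually: `L X n` involves every `X k` with k ≤ n,
-- so a uniform bound passes through `L` term by term.
Bounded : (ℕ → ℚ) → (ℕ → ℚ) → Set
Bounded G X = ∃[ K ] (0ℚ ≤ℚ K × ∀ n → ∣ X n ∣ ≤ℚ K * G n)

module _ {G X : ℕ → ℚ} where

  Bounded-≗ : ∀ {Y} → (∀ n → X n ≡ Y n) → Bounded G X → Bounded G Y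
  Bounded-≗ X≗Y (K , 0≤K , bound) = K , 0≤K , λ n → subst (λ x → ∣ x ∣ ≤ℚ K * G n) (X≗Y n) (bound n)

  Bounded-+ : ∀ {Y} → Bounded G X → Bounded G Y → Bounded G (λ n → X n + Y n)
  Bounded-+ {Y} (K , 0≤K , bound) (K′ , 0≤K′ , bound′) =
    K + K′ , +-mono-≤ 0≤K 0≤K′ , λ n → begin
      ∣ X n + Y n ∣         ≤⟨ ∣p+q∣≤∣p∣+∣q∣ (X n) (Y n) ⟩
      ∣ X n ∣ + ∣ Y n ∣     ≤⟨ +-mono-≤ (bound n) (bound′ n) ⟩
      K * G n + K′ * G n    ≡⟨ *-distribʳ-+ (G n) K K′ ⟨
      (K + K′) * G n        ∎
    where open ≤-Reasoning

  Bounded-* : ∀ {F Y} → Bounded G X → Bounded F Y → Bounded (λ n → G n * F n) (λ n → X n * Y n)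
  Bounded-* {F} {Y} (K , 0≤K , bound) (K′ , 0≤K′ , bound′) =
    K * K′ , 0≤*0≤ 0≤K 0≤K′ , λ n → begin
      ∣ X n * Y n ∣             ≡⟨ ∣p*q∣≡∣p∣*∣q∣ (X n) (Y n) ⟩
      ∣ X n ∣ * ∣ Y n ∣         ≤⟨ *-mono-0≤ (0≤∣p∣ (X n)) (bound n) (0≤∣p∣ (Y n)) (bound′ n) ⟩
      (K * G n) * (K′ * F n)    ≡⟨ interchange K (G n) K′ (F n) ⟩
      (K * K′) * (G n * F n)    ∎
    where
    open ≤-Reasoning
    interchange : ∀ a b c d → (a * b) * (c * d) ≡ (a * c) * (b * d)
    interchange = solve-∀ ℚring

  Bounded-scale : ∀ y → Bounded G X → Bounded G (λ n → y * X n)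
  Bounded-scale y (K , 0≤K , bound) =
    ∣ y ∣ * K , 0≤*0≤ (0≤∣p∣ y) 0≤K , λ n → begin
      ∣ y * X n ∣          ≡⟨ ∣p*q∣≡∣p∣*∣q∣ y (X n) ⟩
      ∣ y ∣ * ∣ X n ∣      ≤⟨ *-monoˡ-0≤ (0≤∣p∣ y) (bound n) ⟩
      ∣ y ∣ * (K * G n)    ≡⟨ *-assoc ∣ y ∣ K (G n) ⟨
      ∣ y ∣ * K * G n      ∎
    where open ≤-Reasoning

  Bounded-weaken : ∀ {F} y → 0ℚ ≤ℚ y → (∀ n → G n ≤ℚ y * F n) → Bounded G X → Bounded F X
  Bounded-weaken {F} y 0≤y G≤yF (K , 0≤K , bound) =
    K * y , 0≤*0≤ 0≤K 0≤y , λ n → begin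
      ∣ X n ∣          ≤⟨ bound n ⟩
      K * G n          ≤⟨ *-monoˡ-0≤ 0≤K (G≤yF n) ⟩
      K * (y * F n)    ≡⟨ *-assoc K y (F n) ⟨
      K * y * F n      ∎
    where open ≤-Reasoning

  -- The value at 0 is absorbed by enlarging the constant by ∣X 0∣ / G 0. This recovers the index 0
  -- about which `moment-suc` says nothing.
  Bounded-suc : (∀ n → 0ℚ < G n) → Bounded (G ∘ suc) (X ∘ suc) → Bounded G X
  Bounded-suc 0<G (K , 0≤K , bound) = K + K₀ , +-mono-≤ 0≤K 0≤K₀ , go
    where
    instance
      G₀-pos : Positive (G 0)
      G₀-pos = positive (0<G 0)
      G₀-nonZero : NonZero (G 0)
      G₀-nonZero = pos⇒nonZero (G 0)
    K₀ : ℚ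
    K₀ = ∣ X 0 ∣ * 1/ (G 0)
    0≤K₀ : 0ℚ ≤ℚ K₀
    0≤K₀ = 0≤*0≤ (0≤∣p∣ (X 0)) (<⇒≤ (positive⁻¹ (1/ (G 0)) {{1/pos⇒pos (G 0)}}))
    go : ∀ n → ∣ X n ∣ ≤ℚ (K + K₀) * G n
    go zero = begin
      ∣ X 0 ∣                        ≡⟨ *-identityʳ ∣ X 0 ∣ ⟨
      ∣ X 0 ∣ * 1ℚ                   ≡⟨ cong (∣ X 0 ∣ *_) (*-inverseˡ (G 0)) ⟨
      ∣ X 0 ∣ * (1/ (G 0) * G 0)     ≡⟨ *-assoc ∣ X 0 ∣ (1/ (G 0)) (G 0) ⟨
      K₀ * G 0                       ≡⟨ cong (_* G 0) (+-identityˡ K₀) ⟨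
      (0ℚ + K₀) * G 0                ≤⟨ *-monoʳ-0≤ (<⇒≤ (0<G 0)) (+-monoˡ-≤ K₀ 0≤K) ⟩
      (K + K₀) * G 0                 ∎
      where open ≤-Reasoning
    go (suc n) = begin
      ∣ X (suc n) ∣                  ≤⟨ bound n ⟩
      K * G (suc n)                  ≡⟨ cong (_* G (suc n)) (+-identityʳ K) ⟨
      (K + 0ℚ) * G (suc n)           ≤⟨ *-monoʳ-0≤ (<⇒≤ (0<G (suc n))) (+-monoʳ-≤ K 0≤K₀) ⟩
      (K + K₀) * G (suc n)           ∎
      where open ≤-Reasoning

Bounded-refl : ∀ {G} → (∀ n → 0ℚ ≤ℚ G n) → Bounded G G
Bounded-refl {G} 0≤G = 1ℚ , nonNegative⁻¹ 1ℚ , λ n →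
  ≤-reflexive (trans (0≤p⇒∣p∣≡p (0≤G n)) (sym (*-identityˡ (G n))))

-- The operator L and the asymptotic scale H

ℚ-semiring : CommSemiring
ℚ-semiring = record { isCommutativeSemiring = IsCommutativeRing.isCommutativeSemiring +-*-isCommutativeRing }

open TreeSums ℚ-semiring

2ℚ 4ℚ 6ℚ ½ℚ ¼ℚ : ℚ
2ℚ = ℤ.+ 2 / 1
4ℚ = ℤ.+ 4 / 1
6ℚ = ℤ.+ 6 / 1
½ℚ = ℤ.+ 1 / 2
¼ℚ = ℤ.+ 1 / 4

0≤ι : ∀ n → 0ℚ ≤ℚ ι n
0≤ι zero    = ≤-refl
0≤ι (suc n) = +-mono-≤ (nonNegative⁻¹ 1ℚ) (0≤ι n)

0<ι-suc : ∀ n → 0ℚ < ι (suc n)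
0<ι-suc n = +-mono-<-≤ (positive⁻¹ 1ℚ) (0≤ι n)

0≤coeff : ∀ m n → 0ℚ ≤ℚ coeff m n
0≤coeff zero    zero    = nonNegative⁻¹ 1ℚ
0≤coeff zero    (suc n) = ≤-refl
0≤coeff (suc m) zero    = ≤-refl
0≤coeff (suc m) (suc n) = +-mono-≤ (0≤coeff m n) (0≤*0≤ (nonNegative⁻¹ 2ℚ) (0≤coeff (suc m) n))

∣∑∣≤ : ∀ (ks : List ℕ) (w A G : ℕ → ℚ) K → (∀ k → 0ℚ ≤ℚ w k) → (∀ k → ∣ A k ∣ ≤ℚ K * G k) →
  ∣ ∑ ks (λ k → w k * A k) ∣ ≤ℚ K * ∑ ks (λ k → w k * G k)
∣∑∣≤ []       w A G K 0≤w A≤KG = ≤-reflexive (sym (*-zeroʳ K))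
∣∑∣≤ (k ∷ ks) w A G K 0≤w A≤KG = begin
  ∣ w k * A k + ∑ ks (λ k → w k * A k) ∣
    ≤⟨ ∣p+q∣≤∣p∣+∣q∣ (w k * A k) (∑ ks (λ k → w k * A k)) ⟩
  ∣ w k * A k ∣ + ∣ ∑ ks (λ k → w k * A k) ∣
    ≡⟨ cong (_+ ∣ ∑ ks (λ k → w k * A k) ∣) (trans (∣p*q∣≡∣p∣*∣q∣ (w k) (A k)) (cong (_* ∣ A k ∣) (0≤p⇒∣p∣≡p (0≤w k)))) ⟩
  w k * ∣ A k ∣ + ∣ ∑ ks (λ k → w k * A k) ∣
    ≤⟨ +-mono-≤ (*-monoˡ-0≤ (0≤w k) (A≤KG k)) (∣∑∣≤ ks w A G K 0≤w A≤KG) ⟩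
  w k * (K * G k) + K * ∑ ks (λ k → w k * G k)
    ≡⟨ factor (w k) K (G k) (∑ ks (λ k → w k * G k)) ⟩
  K * (w k * G k + ∑ ks (λ k → w k * G k)) ∎
  where
  open ≤-Reasoning
  factor : ∀ w K g s → w * (K * g) + K * s ≡ K * (w * g + s)
  factor = solve-∀ ℚring

L-Bounded : ∀ {G X} → Bounded G X → Bounded (L G) (L X)
L-Bounded {G} {X} (K , 0≤K , bound) = K , 0≤K , λ n →
  ∣∑∣≤ (upTo (suc n)) (oddWeight n) X G K (λ k → 0≤coeff (suc (k ℕ.+ k)) (suc n)) bound

N : (ℕ → ℚ) → ℕ → ℚ
N A n = 4ℚ * A n - A (suc n)

L-N : ∀ A n → L (N A) n ≡ N (L A) (suc n)
L-N A n = begin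
  L (N A) n
    ≡⟨ L-cong (λ k → cong (4ℚ * A k +_) (neg-1 (A (suc k)))) n ⟩
  L (λ k → 4ℚ * A k + (- 1ℚ) * A (suc k)) n
    ≡⟨ L-+ (λ k → 4ℚ * A k) (λ k → (- 1ℚ) * A (suc k)) n ⟩
  L (λ k → 4ℚ * A k) n + L (λ k → (- 1ℚ) * A (suc k)) n
    ≡⟨ cong₂ _+_ (L-*ˡ 4ℚ A n) (L-*ˡ (- 1ℚ) (A ∘ suc) n) ⟩
  4ℚ * L A n + (- 1ℚ) * L (A ∘ suc) n
    ≡⟨ rearrange₁ (L A n) (L (A ∘ suc) n) (L A (suc (suc n))) ⟩
  (L A (suc (suc n)) + 4ℚ * L A n) - L (A ∘ suc) n - L A (suc (suc n))
    ≡⟨ cong (λ x → x - L (A ∘ suc) n - L A (suc (suc n))) (L-shift A n) ⟩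
  (L (A ∘ suc) n + 4ℚ * L A (suc n)) - L (A ∘ suc) n - L A (suc (suc n))
    ≡⟨ rearrange₂ (L (A ∘ suc) n) (L A (suc n)) (L A (suc (suc n))) ⟩
  4ℚ * L A (suc n) - L A (suc (suc n)) ∎
  where
  open ≡-Reasoning
  neg-1 : ∀ x → - x ≡ (- 1ℚ) * x
  neg-1 = solve-∀ ℚring
  rearrange₁ : ∀ x y z → 4ℚ * x + (- 1ℚ) * y ≡ (z + 4ℚ * x) - y - z
  rearrange₁ = solve-∀ ℚring
  rearrange₂ : ∀ x y z → (x + 4ℚ * y) - x - z ≡ 4ℚ * y - z
  rearrange₂ = solve-∀ ℚring

H : ℕ → ℕ → ℚ
H zero    = catalan
H (suc k) = N (H k)

-- The step takes 4 times the relation at n minus the relation at n + 1; the latter carries exactly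
-- the factor k + n + 3 of the next level. Positivity of `H`, its decay relative to `catalan` and
-- the expansions in 1/n all come from this recursion.
H-ratio : ∀ k n → ι (suc (suc (k ℕ.+ n))) * H (suc k) n ≡ (4ℚ * ι k + 6ℚ) * H k n
H-ratio zero n = begin
  (1ℚ + (1ℚ + ι n)) * (4ℚ * catalan n - catalan (suc n))
    ≡⟨ expand (ι n) (catalan n) (catalan (suc n)) ⟩
  4ℚ * (1ℚ + (1ℚ + ι n)) * catalan n - (1ℚ + (1ℚ + ι n)) * catalan (suc n)
    ≡⟨ cong (λ z → 4ℚ * (1ℚ + (1ℚ + ι n)) * catalan n - z) (catalan-ratio n) ⟩
  4ℚ * (1ℚ + (1ℚ + ι n)) * catalan n - (4ℚ * ι n + 2ℚ) * catalan n
    ≡⟨ collect (ι n) (catalan n) ⟩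
  (4ℚ * 0ℚ + 6ℚ) * catalan n ∎
  where
  open ≡-Reasoning
  expand : ∀ x y z → (1ℚ + (1ℚ + x)) * (4ℚ * y - z) ≡ 4ℚ * (1ℚ + (1ℚ + x)) * y - (1ℚ + (1ℚ + x)) * z
  expand = solve-∀ ℚring
  collect : ∀ x y → 4ℚ * (1ℚ + (1ℚ + x)) * y - (4ℚ * x + 2ℚ) * y ≡ (4ℚ * 0ℚ + 6ℚ) * y
  collect = solve-∀ ℚring
H-ratio (suc k) n = begin
  (1ℚ + x) * (4ℚ * (4ℚ * h - h₁) - H (suc k) (suc n))
    ≡⟨ expand x h h₁ (H (suc k) (suc n)) ⟩
  4ℚ * (4ℚ * h - h₁) + 4ℚ * (x * (4ℚ * h - h₁)) - (1ℚ + x) * H (suc k) (suc n)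
    ≡⟨ cong₂ (λ u v → 4ℚ * (4ℚ * h - h₁) + 4ℚ * u - v) (H-ratio k n)
         (subst (λ m → ι (suc (suc m)) * H (suc k) (suc n) ≡ (4ℚ * ι k + 6ℚ) * h₁) (ℕₚ.+-suc k n) (H-ratio k (suc n))) ⟩
  4ℚ * (4ℚ * h - h₁) + 4ℚ * ((4ℚ * ι k + 6ℚ) * h) - (4ℚ * ι k + 6ℚ) * h₁
    ≡⟨ collect (ι k) h h₁ ⟩
  (4ℚ * (1ℚ + ι k) + 6ℚ) * (4ℚ * h - h₁) ∎
  where
  open ≡-Reasoning
  x h h₁ : ℚ
  x = ι (suc (suc (k ℕ.+ n)))
  h = H k n
  h₁ = H k (suc n)
  expand : ∀ x h h₁ g → (1ℚ + x) * (4ℚ * (4ℚ * h - h₁) - g) ≡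
    4ℚ * (4ℚ * h - h₁) + 4ℚ * (x * (4ℚ * h - h₁)) - (1ℚ + x) * g
  expand = solve-∀ ℚring
  collect : ∀ k h h₁ → 4ℚ * (4ℚ * h - h₁) + 4ℚ * ((4ℚ * k + 6ℚ) * h) - (4ℚ * k + 6ℚ) * h₁ ≡
    (4ℚ * (1ℚ + k) + 6ℚ) * (4ℚ * h - h₁)
  collect = solve-∀ ℚring

0<catalan : ∀ n → 0ℚ < catalan n
0<catalan zero    = positive⁻¹ 1ℚ
0<catalan (suc n) = 0<-cancelˡ (0<ι-suc (suc n)) (subst (0ℚ <_) (sym (catalan-ratio n))
  (0<*0< (+-mono-≤-< (0≤*0≤ (nonNegative⁻¹ 4ℚ) (0≤ι n)) (positive⁻¹ 2ℚ)) (0<catalan n)))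

0<H : ∀ k n → 0ℚ < H k n
0<H zero    n = 0<catalan n
0<H (suc k) n = 0<-cancelˡ (0<ι-suc (suc (k ℕ.+ n))) (subst (0ℚ <_) (sym (H-ratio k n))
  (0<*0< (+-mono-≤-< (0≤*0≤ (nonNegative⁻¹ 4ℚ) (0≤ι k)) (positive⁻¹ 6ℚ)) (0<H k n)))

H-next : ∀ k n → H k (suc n) ≡ 4ℚ * H k n - H (suc k) n
H-next k n = identity (H k (suc n)) (4ℚ * H k n)
  where
  identity : ∀ x y → x ≡ y - (y - x)
  identity = solve-∀ ℚring

H-suc-≤ : ∀ k n → H k (suc n) ≤ℚ 4ℚ * H k n
H-suc-≤ k n = subst (_≤ℚ 4ℚ * H k n) (sym (H-next k n)) (p-q≤p (<⇒≤ (0<H (suc k) n)))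

H-step : ∀ k n → ι (suc (suc (k ℕ.+ n))) * H k (suc n) ≡ (4ℚ * ι n + 2ℚ) * H k n
H-step k n = begin
  (1ℚ + (1ℚ + ι (k ℕ.+ n))) * H k (suc n)
    ≡⟨ cong (x *_) (H-next k n) ⟩
  x * (4ℚ * H k n - H (suc k) n)
    ≡⟨ expand x (H k n) (H (suc k) n) ⟩
  4ℚ * x * H k n - x * H (suc k) n
    ≡⟨ cong₂ (λ y z → 4ℚ * (1ℚ + (1ℚ + y)) * H k n - z) (ι-+ k n) (H-ratio k n) ⟩
  4ℚ * (1ℚ + (1ℚ + (ι k + ι n))) * H k n - (4ℚ * ι k + 6ℚ) * H k n
    ≡⟨ collect (ι k) (ι n) (H k n) ⟩
  (4ℚ * ι n + 2ℚ) * H k n ∎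
  where
  open ≡-Reasoning
  x : ℚ
  x = ι (suc (suc (k ℕ.+ n)))
  expand : ∀ x h g → x * (4ℚ * h - g) ≡ 4ℚ * x * h - x * g
  expand = solve-∀ ℚring
  collect : ∀ k n h → 4ℚ * (1ℚ + (1ℚ + (k + n))) * h - (4ℚ * k + 6ℚ) * h ≡ (4ℚ * n + 2ℚ) * h
  collect = solve-∀ ℚring

-- `L-B` and `L-W` leave terms at earlier indices than the one of comparison, so `H k` must also be
-- bounded by its next value. The crude factor k + 2 works because (k+2)(4n+2) exceeds n + k + 2 by
-- (k+2) + 4kn + 7n.
H-≤-suc : ∀ k n → H k n ≤ℚ ι (suc (suc k)) * H k (suc n)
H-≤-suc k n = *-cancelˡ-≤-pos x {{positive (0<ι-suc (suc (k ℕ.+ n)))}} (begin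
  x * H k n
    ≤⟨ *-monoʳ-0≤ (<⇒≤ (0<H k n)) x≤ ⟩
  y * (4ℚ * ι n + 2ℚ) * H k n
    ≡⟨ *-assoc y (4ℚ * ι n + 2ℚ) (H k n) ⟩
  y * ((4ℚ * ι n + 2ℚ) * H k n)
    ≡⟨ cong (y *_) (H-step k n) ⟨
  y * (x * H k (suc n))
    ≡⟨ swap y x (H k (suc n)) ⟩
  x * (y * H k (suc n)) ∎)
  where
  open ≤-Reasoning
  x y : ℚ
  x = ι (suc (suc (k ℕ.+ n)))
  y = ι (suc (suc k))
  swap : ∀ x y z → x * (y * z) ≡ y * (x * z)
  swap = solve-∀ ℚring
  x≤ : x ≤ℚ y * (4ℚ * ι n + 2ℚ)
  x≤ = begin
    x
      ≡⟨ cong (λ z → 1ℚ + (1ℚ + z)) (ι-+ k n) ⟩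
    1ℚ + (1ℚ + (ι k + ι n))
      ≡⟨ +-identityʳ _ ⟨
    1ℚ + (1ℚ + (ι k + ι n)) + 0ℚ
      ≤⟨ +-monoʳ-≤ (1ℚ + (1ℚ + (ι k + ι n))) (+-mono-≤ (+-mono-≤ (0≤ι (2 ℕ.+ k)) (0≤*0≤ (0≤*0≤ (nonNegative⁻¹ 4ℚ) (0≤ι k)) (0≤ι n)))
           (0≤*0≤ (nonNegative⁻¹ (ℤ.+ 7 / 1)) (0≤ι n))) ⟩
    1ℚ + (1ℚ + (ι k + ι n)) + (ι (2 ℕ.+ k) + 4ℚ * ι k * ι n + (ℤ.+ 7 / 1) * ι n)
      ≡⟨ collect (ι k) (ι n) ⟩
    y * (4ℚ * ι n + 2ℚ) ∎
    where
    collect : ∀ k n → 1ℚ + (1ℚ + (k + n)) + ((1ℚ + (1ℚ + k)) + 4ℚ * k * n + (ℤ.+ 7 / 1) * n) ≡ (1ℚ + (1ℚ + k)) * (4ℚ * n + 2ℚ)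
    collect = solve-∀ ℚring

-- Each `N` adds one shift when `L-N` moves it out of `L`, on top of the shift in `L-catalan`.
L-H : ∀ k n → L (H k) n ≡ H k (k ℕ.+ suc n)
L-H zero    n = L-catalan n
L-H (suc k) n = begin
  L (N (H k)) n
    ≡⟨ L-N (H k) n ⟩
  4ℚ * L (H k) (suc n) - L (H k) (suc (suc n))
    ≡⟨ cong₂ (λ x y → 4ℚ * x - y) (L-H k (suc n)) (L-H k (suc (suc n))) ⟩
  4ℚ * H k (k ℕ.+ suc (suc n)) - H k (k ℕ.+ suc (suc (suc n)))
    ≡⟨ cong₂ (λ i j → 4ℚ * H k i - H k j) (ℕₚ.+-suc k (suc n)) (trans (ℕₚ.+-suc k (suc (suc n))) (cong suc (ℕₚ.+-suc k (suc n)))) ⟩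
  H (suc k) (suc k ℕ.+ suc n) ∎
  where open ≡-Reasoning

4^ : ℕ → ℚ
4^ zero    = 1ℚ
4^ (suc j) = 4ℚ * 4^ j

0≤4^ : ∀ j → 0ℚ ≤ℚ 4^ j
0≤4^ zero    = nonNegative⁻¹ 1ℚ
0≤4^ (suc j) = 0≤*0≤ (nonNegative⁻¹ 4ℚ) (0≤4^ j)

H-+-≤ : ∀ k j n → H k (j ℕ.+ n) ≤ℚ 4^ j * H k n
H-+-≤ k zero    n = ≤-reflexive (sym (*-identityˡ (H k n)))
H-+-≤ k (suc j) n = begin
  H k (suc (j ℕ.+ n))         ≤⟨ H-suc-≤ k (j ℕ.+ n) ⟩
  4ℚ * H k (j ℕ.+ n)          ≤⟨ *-monoˡ-0≤ (nonNegative⁻¹ 4ℚ) (H-+-≤ k j n) ⟩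
  4ℚ * (4^ j * H k n)         ≡⟨ *-assoc 4ℚ (4^ j) (H k n) ⟨
  4ℚ * 4^ j * H k n           ∎
  where open ≤-Reasoning

Bounded-L-H : ∀ k {X} → Bounded (H k) X → Bounded (H k ∘ suc) (L X)
Bounded-L-H k bd = Bounded-weaken (4^ k) (0≤4^ k)
  (λ n → subst (_≤ℚ 4^ k * H k (suc n)) (sym (L-H k n)) (H-+-≤ k k (suc n))) (L-Bounded bd)

-- First and second moments

-- `B n` is the central binomial coefficient. By `N-B` and `N-W`, up to constant factors, `B` and
-- `W` continue the chain `H` to the indices -1 and -2.
B W : ℕ → ℚ
B n = ι (suc n) * catalan n
W n = ι n * B n

N-B : ∀ n → N B n ≡ 2ℚ * catalan n
N-B n = trans
  (cong (λ z → 4ℚ * B n - z) (catalan-ratio n))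
  (solve 2 (λ x y → con 4ℚ :* ((con 1ℚ :+ x) :* y) :- (con 4ℚ :* x :+ con 2ℚ) :* y := con 2ℚ :* y) refl (ι n) (catalan n))

B-suc : ∀ n → B (suc n) ≡ 4ℚ * B n - 2ℚ * catalan n
B-suc n = trans (solve 2 (λ x y → y := x :- (x :- y)) refl (4ℚ * B n) (B (suc n))) (cong (λ z → 4ℚ * B n - z) (N-B n))

N-W : ∀ n → N W n ≡ (- 2ℚ) * B n
N-W n = trans
  (cong (λ x → 4ℚ * W n - ι (suc n) * x) (catalan-ratio n))
  (solve 2 (λ x y → con 4ℚ :* (x :* ((con 1ℚ :+ x) :* y)) :- (con 1ℚ :+ x) :* ((con 4ℚ :* x :+ con 2ℚ) :* y) :=
     con (- 2ℚ) :* ((con 1ℚ :+ x) :* y)) refl (ι n) (catalan n))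

W-suc : ∀ n → W (suc n) ≡ 4ℚ * W n + 2ℚ * B n
W-suc n = trans (solve 2 (λ x y → y := x :- (x :- y)) refl (4ℚ * W n) (W (suc n)))
  (trans (cong (λ z → 4ℚ * W n - z) (N-W n)) (solve 2 (λ x y → con 4ℚ :* x :- con (- 2ℚ) :* y := con 4ℚ :* x :+ con 2ℚ :* y) refl (W n) (B n)))

L-next : ∀ A n → L A (suc (suc n)) ≡ 4ℚ * L A (suc n) - L (N A) n
L-next A n = trans (solve 2 (λ x y → y := x :- (x :- y)) refl (4ℚ * L A (suc n)) (L A (suc (suc n))))
  (cong (λ z → 4ℚ * L A (suc n) - z) (sym (L-N A n)))

-- Through `L-N`, the identity N B = 2C becomes a first-order recursion for `L B` with known
-- inhomogeneity `L catalan`. It takes effect from index 2, hence two base cases by evaluation.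
L-B : ∀ n → L B n ≡ ¼ℚ * B (suc n) + ½ℚ * catalan n
L-B zero          = refl
L-B (suc zero)    = refl
L-B (suc (suc n)) = begin
  L B (suc (suc n))
    ≡⟨ L-next B n ⟩
  4ℚ * L B (suc n) - L (N B) n
    ≡⟨ cong₂ (λ x y → 4ℚ * x - y) (L-B (suc n))
         (trans (L-cong N-B n) (trans (L-*ˡ 2ℚ catalan n) (cong (2ℚ *_) (L-catalan n)))) ⟩
  4ℚ * (¼ℚ * B (suc (suc n)) + ½ℚ * catalan (suc n)) - 2ℚ * catalan (suc n)
    ≡⟨ solve 3 (λ u x y → con 4ℚ :* (con ¼ℚ :* u :+ con ½ℚ :* x) :- con 2ℚ :* x :=
         con ¼ℚ :* (con 4ℚ :* u :- con 2ℚ :* y) :+ con ½ℚ :* y) refl (B (suc (suc n))) (catalan (suc n)) (catalan (suc (suc n))) ⟩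
  ¼ℚ * (4ℚ * B (suc (suc n)) - 2ℚ * catalan (suc (suc n))) + ½ℚ * catalan (suc (suc n))
    ≡⟨ cong (λ x → ¼ℚ * x + ½ℚ * catalan (suc (suc n))) (B-suc (suc (suc n))) ⟨
  ¼ℚ * B (suc (suc (suc n))) + ½ℚ * catalan (suc (suc n)) ∎
  where open ≡-Reasoning

⅛ℚ 1/16ℚ : ℚ
⅛ℚ = ℤ.+ 1 / 8
1/16ℚ = ℤ.+ 1 / 16

-- The same recursion argument one level down, with N W = -2B and `L-B` as inhomogeneity. The index
-- is shifted because `catalan n` lies two steps behind `W (suc (suc n))`.
L-W : ∀ n → L W (suc n) ≡
  1/16ℚ * W (suc (suc n)) - 1/16ℚ * B (suc (suc n)) - ⅛ℚ * catalan (suc n) - ¼ℚ * catalan n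
L-W zero    = refl
L-W (suc n) = begin
  L W (suc (suc n))
    ≡⟨ L-next W n ⟩
  4ℚ * L W (suc n) - L (N W) n
    ≡⟨ cong₂ (λ x y → 4ℚ * x - y) (L-W n)
         (trans (L-cong N-W n) (trans (L-*ˡ (- 2ℚ) B n) (cong ((- 2ℚ) *_) (L-B n)))) ⟩
  4ℚ * (1/16ℚ * W₂ - 1/16ℚ * B (suc (suc n)) - ⅛ℚ * C₁ - ¼ℚ * catalan n) - (- 2ℚ) * (¼ℚ * B (suc n) + ½ℚ * catalan n)
    ≡⟨ cong (λ u → 4ℚ * (1/16ℚ * W₂ - 1/16ℚ * u - ⅛ℚ * C₁ - ¼ℚ * catalan n) - (- 2ℚ) * (¼ℚ * B (suc n) + ½ℚ * catalan n))
         (B-suc (suc n)) ⟩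
  4ℚ * (1/16ℚ * W₂ - 1/16ℚ * (4ℚ * B (suc n) - 2ℚ * C₁) - ⅛ℚ * C₁ - ¼ℚ * catalan n) - (- 2ℚ) * (¼ℚ * B (suc n) + ½ℚ * catalan n)
    ≡⟨ solve 5 (λ w u x y z →
         con 4ℚ :* (con 1/16ℚ :* w :- con 1/16ℚ :* (con 4ℚ :* u :- con 2ℚ :* y) :- con ⅛ℚ :* y :- con ¼ℚ :* z)
           :- con (- 2ℚ) :* (con ¼ℚ :* u :+ con ½ℚ :* z) :=
         con 1/16ℚ :* (con 4ℚ :* w :+ con 2ℚ :* (con 4ℚ :* u :- con 2ℚ :* y))
           :- con 1/16ℚ :* (con 4ℚ :* (con 4ℚ :* u :- con 2ℚ :* y) :- con 2ℚ :* x) :- con ⅛ℚ :* x :- con ¼ℚ :* y)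
         refl W₂ (B (suc n)) C₂ C₁ (catalan n) ⟩
  1/16ℚ * (4ℚ * W₂ + 2ℚ * (4ℚ * B (suc n) - 2ℚ * C₁)) - 1/16ℚ * (4ℚ * (4ℚ * B (suc n) - 2ℚ * C₁) - 2ℚ * C₂) - ⅛ℚ * C₂ - ¼ℚ * C₁
    ≡⟨ cong (λ u → 1/16ℚ * (4ℚ * W₂ + 2ℚ * u) - 1/16ℚ * (4ℚ * u - 2ℚ * C₂) - ⅛ℚ * C₂ - ¼ℚ * C₁) (B-suc (suc n)) ⟨
  1/16ℚ * (4ℚ * W₂ + 2ℚ * B (suc (suc n))) - 1/16ℚ * (4ℚ * B (suc (suc n)) - 2ℚ * C₂) - ⅛ℚ * C₂ - ¼ℚ * C₁
    ≡⟨ cong₂ (λ w u → 1/16ℚ * w - 1/16ℚ * u - ⅛ℚ * C₂ - ¼ℚ * C₁) (W-suc (suc (suc n))) (B-suc (suc (suc n))) ⟨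
  1/16ℚ * W (suc (suc (suc n))) - 1/16ℚ * B (suc (suc (suc n))) - ⅛ℚ * C₂ - ¼ℚ * C₁ ∎
  where
  open ≡-Reasoning
  W₂ C₁ C₂ : ℚ
  W₂ = W (suc (suc n))
  C₁ = catalan (suc n)
  C₂ = catalan (suc (suc n))

α : ℕ → ℚ
α zero    = 1ℚ
α (suc r) = ¼ℚ * α r

-- With a = 4⁻ʳ and b = 4ʳ, these solve the recursions that L induces on the coefficients of the
-- moments: μ₀′ = μ₀ + a/8, μ₁′ = 4μ₁ + a/32, μ₂′ = 16μ₂ - μ₁ + a/128, all 0 at r = 0.
μ₀ μ₁ μ₂ : ℚ → ℚ → ℚ
μ₀ a b = (ℤ.+ 1 / 6) * (1ℚ - a)
μ₁ a b = (ℤ.+ 1 / 120) * (b - a)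
μ₂ a b = (ℤ.+ 1 / 3024) * (b * b) + (ℤ.+ 1 / 1440) * b - (ℤ.+ 31 / 30240) * a

mean : ℚ → ℚ → ℕ → ℚ
mean a b n = a * B n + μ₀ a b * catalan n + μ₁ a b * H 1 n + μ₂ a b * H 2 n

-- Likewise ν₋₁′ = ν₋₁/4 - a²/16, ν₀′ = ν₀ + ν₋₁/8 - 3a²/64, ν₁′ = 4ν₁ + ν₋₁/32 - a²/64,
-- starting from 1, 0, 0.
ν₋₁ ν₀ ν₁ : ℚ → ℚ → ℚ
ν₋₁ a b = (ℤ.+ 2 / 3) * a + (ℤ.+ 1 / 3) * (a * a)
ν₀  a b = (ℤ.+ 19 / 180) - (ℤ.+ 1 / 9) * a + (ℤ.+ 1 / 180) * (a * a)
ν₁  a b = (ℤ.+ 4 / 945) * b - (ℤ.+ 1 / 180) * a + (ℤ.+ 1 / 756) * (a * a)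

meanSquare : ℚ → ℚ → ℕ → ℚ
meanSquare a b n = a * a * W n + ν₋₁ a b * B n + ν₀ a b * catalan n + ν₁ a b * H 1 n

Bounded-0 : ∀ {G X} → (∀ n → X n ≡ 0ℚ) → Bounded G X
Bounded-0 {G} X≡0 = 0ℚ , ≤-refl , λ n → ≤-reflexive (trans (cong ∣_∣ (X≡0 n)) (sym (*-zeroˡ (G n))))

Bounded-H : ∀ k → Bounded (H k) (H k)
Bounded-H k = Bounded-refl (λ n → <⇒≤ (0<H k n))

L-combination : ∀ x₁ x₂ x₃ x₄ A₁ A₂ A₃ A₄ n →
  L (λ k → x₁ * A₁ k + x₂ * A₂ k + x₃ * A₃ k + x₄ * A₄ k) n ≡
  x₁ * L A₁ n + x₂ * L A₂ n + x₃ * L A₃ n + x₄ * L A₄ n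
L-combination x₁ x₂ x₃ x₄ A₁ A₂ A₃ A₄ n =
  trans (L-+ (λ k → x₁ * A₁ k + x₂ * A₂ k + x₃ * A₃ k) (λ k → x₄ * A₄ k) n)
    (cong₂ _+_ (trans (L-+ (λ k → x₁ * A₁ k + x₂ * A₂ k) (λ k → x₃ * A₃ k) n)
      (cong₂ _+_ (trans (L-+ (λ k → x₁ * A₁ k) (λ k → x₂ * A₂ k) n)
        (cong₂ _+_ (L-*ˡ x₁ A₁ n) (L-*ˡ x₂ A₂ n))) (L-*ˡ x₃ A₃ n))) (L-*ˡ x₄ A₄ n))

L-minus : ∀ A A′ n → L (λ k → A k - A′ k) n ≡ L A n - L A′ n
L-minus A A′ n = trans (L-cong (λ k → cong (A k +_) (neg-1 (A′ k))) n)
  (trans (L-+ A (λ k → (- 1ℚ) * A′ k) n)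
    (trans (cong (L A n +_) (L-*ˡ (- 1ℚ) A′ n)) (cong (L A n +_) (sym (neg-1 (L A′ n))))))
  where
  neg-1 : ∀ x → - x ≡ (- 1ℚ) * x
  neg-1 = solve-∀ ℚring

-- The new error is `L` of the old one, controlled by `Bounded-L-H`, plus the defect of the ansatz
-- `F′` against `L F`.
Bounded-L-step : ∀ k φ r (F F′ : ℕ → ℚ) → Bounded (H k) (λ n → moment φ r n - F n) →
  Bounded (H k ∘ suc) (λ n → L F n - F′ (suc n)) →
  Bounded (H k) (λ n → moment φ (suc r) n - F′ n)
Bounded-L-step k φ r F F′ bd bd′ = Bounded-suc (0<H k)
  (Bounded-≗ (λ n → trans
    (cong (_+ (L F n - F′ (suc n))) (trans (L-minus (moment φ r) F n) (cong (_- L F n) (sym (moment-suc φ r n)))))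
    (telescope (moment φ (suc r) (suc n)) (L F n) (F′ (suc n))))
  (Bounded-+ (Bounded-L-H k bd) bd′))
  where
  telescope : ∀ x y z → (x - y) + (y - z) ≡ x - z
  telescope = solve-∀ ℚring

-- Everything is re-expanded at n + 1, where unmarked terms are taken: C(n) = C/4 + H₁/16 + H₂/64 +
-- H₃(n)/64, H₁(n+2) = 4H₁ - H₂ and H₂(n+3) = 16H₂ - 4H₃ - H₃(n+2). With the factor 1/2 of `L-B`
-- this produces the increments a/8, a/32 and a/128; the right side collects the `H 3` terms.
mean-step : ∀ a b n → L (mean a b) n - mean (¼ℚ * a) (4ℚ * b) (suc n) ≡
  (ℤ.+ 1 / 128) * a * H 3 n + - μ₂ a b * (4ℚ * H 3 (suc n) + H 3 (suc (suc n)))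
mean-step a b n = begin
  L (mean a b) n - mean (¼ℚ * a) (4ℚ * b) (suc n)
    ≡⟨ cong (_- mean (¼ℚ * a) (4ℚ * b) (suc n)) (trans
         (L-combination a (μ₀ a b) (μ₁ a b) (μ₂ a b) B catalan (H 1) (H 2) n)
         (cong₂ _+_ (cong₂ _+_ (cong₂ _+_ (cong (a *_) (L-B n)) (cong (μ₀ a b *_) (L-catalan n)))
           (cong (μ₁ a b *_) (L-H 1 n))) (cong (μ₂ a b *_) (L-H 2 n)))) ⟩
  a * (¼ℚ * B (suc n) + ½ℚ * catalan n) + μ₀ a b * catalan (suc n) + μ₁ a b * H 1 (1 ℕ.+ suc n) + μ₂ a b * H 2 (2 ℕ.+ suc n)
    - mean (¼ℚ * a) (4ℚ * b) (suc n)
    -- Unfolding every `H` into six consecutive Catalan numbers, taken as independent variables,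
    -- leaves a polynomial identity.
    ≡⟨ solve 9 (λ a b u c₀ c₁ c₂ c₃ c₄ c₅ →
         let h₁ x y = con 4ℚ :* x :- y
             h₂ x y z = h₁ (h₁ x y) (h₁ y z)
             h₃ x y z w = h₁ (h₂ x y z) (h₂ y z w)
             m₀ a b = con (ℤ.+ 1 / 6) :* (con 1ℚ :- a)
             m₁ a b = con (ℤ.+ 1 / 120) :* (b :- a)
             m₂ a b = con (ℤ.+ 1 / 3024) :* (b :* b) :+ con (ℤ.+ 1 / 1440) :* b :- con (ℤ.+ 31 / 30240) :* a
             a′ = con ¼ℚ :* a
             b′ = con 4ℚ :* b
         in a :* (con ¼ℚ :* u :+ con ½ℚ :* c₀) :+ m₀ a b :* c₁ :+ m₁ a b :* h₁ c₂ c₃ :+ m₂ a b :* h₂ c₃ c₄ c₅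
              :- (a′ :* u :+ m₀ a′ b′ :* c₁ :+ m₁ a′ b′ :* h₁ c₁ c₂ :+ m₂ a′ b′ :* h₂ c₁ c₂ c₃) :=
            con (ℤ.+ 1 / 128) :* a :* h₃ c₀ c₁ c₂ c₃ :+ :- m₂ a b :* (con 4ℚ :* h₃ c₁ c₂ c₃ c₄ :+ h₃ c₂ c₃ c₄ c₅))
         refl a b (B (suc n)) (catalan n) (catalan (1 ℕ.+ n)) (catalan (2 ℕ.+ n)) (catalan (3 ℕ.+ n)) (catalan (4 ℕ.+ n)) (catalan (5 ℕ.+ n)) ⟩
  (ℤ.+ 1 / 128) * a * H 3 n + - μ₂ a b * (4ℚ * H 3 (suc n) + H 3 (suc (suc n))) ∎
  where open ≡-Reasoning

moment₁ : ∀ r → Bounded (H 3) (λ n → moment ι r n - mean (α r) (4^ r) n)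
-- For r = 0 the moment is exactly `B`, and all three μ vanish at a = b = 1.
moment₁ zero    = Bounded-0 (λ n → trans
  (cong (_- mean 1ℚ 1ℚ n) (moment-zero ι n))
  (solve 4 (λ u c h₁ h₂ → u :- (con 1ℚ :* u :+ con (μ₀ 1ℚ 1ℚ) :* c :+ con (μ₁ 1ℚ 1ℚ) :* h₁ :+ con (μ₂ 1ℚ 1ℚ) :* h₂) := con 0ℚ)
    refl (B n) (catalan n) (H 1 n) (H 2 n)))
moment₁ (suc r) = Bounded-L-step 3 ι r (mean (α r) (4^ r)) (mean (α (suc r)) (4^ (suc r))) (moment₁ r)
  (Bounded-≗ (λ n → sym (mean-step (α r) (4^ r) n))
    (Bounded-+ (Bounded-scale ((ℤ.+ 1 / 128) * α r) previous)
               (Bounded-scale (- μ₂ (α r) (4^ r)) (Bounded-+ (Bounded-scale 4ℚ same) next))))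
  where
  same : Bounded (H 3 ∘ suc) (H 3 ∘ suc)
  same = Bounded-refl (λ n → <⇒≤ (0<H 3 (suc n)))
  previous : Bounded (H 3 ∘ suc) (H 3)
  previous = Bounded-weaken (ι 5) (0≤ι 5) (H-≤-suc 3) (Bounded-H 3)
  next : Bounded (H 3 ∘ suc) (H 3 ∘ suc ∘ suc)
  next = Bounded-weaken 4ℚ (nonNegative⁻¹ 4ℚ) (λ n → H-suc-≤ 3 (suc n)) (Bounded-refl (λ n → <⇒≤ (0<H 3 (suc (suc n)))))

-- Since `L-W` reaches back two indices, the comparison is made at n + 2, where unmarked terms are
-- taken: C(n+1) = C/4 + H₁/16 + H₂(n+1)/16 and C(n) = C/16 + H₁/32 + H₂(n+1)/32 + H₂(n)/16.
-- Weighted by -a²/8 and -a²/4, they give the 3a²/64 and a²/64 in the recursions of ν₀ and ν₁.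
meanSquare-step : ∀ a b n → L (meanSquare a b) (suc n) - meanSquare (¼ℚ * a) (4ℚ * b) (suc (suc n)) ≡
  ((ℤ.+ 1 / 32) * ν₋₁ a b - (ℤ.+ 1 / 64) * (a * a)) * H 2 (suc n) + - ((ℤ.+ 1 / 64) * (a * a)) * H 2 n + - ν₁ a b * H 2 (suc (suc n))
meanSquare-step a b n = begin
  L (meanSquare a b) (suc n) - meanSquare (¼ℚ * a) (4ℚ * b) (suc (suc n))
    ≡⟨ cong (_- meanSquare (¼ℚ * a) (4ℚ * b) (suc (suc n))) (trans
         (L-combination (a * a) (ν₋₁ a b) (ν₀ a b) (ν₁ a b) W B catalan (H 1) (suc n))
         (cong₂ _+_ (cong₂ _+_ (cong₂ _+_ (cong (a * a *_) (L-W n)) (cong (ν₋₁ a b *_) (L-B (suc n))))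
           (cong (ν₀ a b *_) (L-catalan (suc n)))) (cong (ν₁ a b *_) (L-H 1 (suc n))))) ⟩
  a * a * (1/16ℚ * W (2 ℕ.+ n) - 1/16ℚ * B (2 ℕ.+ n) - ⅛ℚ * catalan (1 ℕ.+ n) - ¼ℚ * catalan n)
    + ν₋₁ a b * (¼ℚ * B (2 ℕ.+ n) + ½ℚ * catalan (1 ℕ.+ n)) + ν₀ a b * catalan (2 ℕ.+ n) + ν₁ a b * H 1 (3 ℕ.+ n)
    - meanSquare (¼ℚ * a) (4ℚ * b) (suc (suc n))
    ≡⟨ solve 9 (λ a b w u c₀ c₁ c₂ c₃ c₄ →
         let h₁ x y = con 4ℚ :* x :- y
             h₂ x y z = h₁ (h₁ x y) (h₁ y z)
             n₋₁ a b = con (ℤ.+ 2 / 3) :* a :+ con (ℤ.+ 1 / 3) :* (a :* a)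
             n₀ a b = con (ℤ.+ 19 / 180) :- con (ℤ.+ 1 / 9) :* a :+ con (ℤ.+ 1 / 180) :* (a :* a)
             n₁ a b = con (ℤ.+ 4 / 945) :* b :- con (ℤ.+ 1 / 180) :* a :+ con (ℤ.+ 1 / 756) :* (a :* a)
             a′ = con ¼ℚ :* a
             b′ = con 4ℚ :* b
         in a :* a :* (con 1/16ℚ :* w :- con 1/16ℚ :* u :- con ⅛ℚ :* c₁ :- con ¼ℚ :* c₀)
              :+ n₋₁ a b :* (con ¼ℚ :* u :+ con ½ℚ :* c₁) :+ n₀ a b :* c₂ :+ n₁ a b :* h₁ c₃ c₄
              :- (a′ :* a′ :* w :+ n₋₁ a′ b′ :* u :+ n₀ a′ b′ :* c₂ :+ n₁ a′ b′ :* h₁ c₂ c₃) :=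
            (con (ℤ.+ 1 / 32) :* n₋₁ a b :- con (ℤ.+ 1 / 64) :* (a :* a)) :* h₂ c₁ c₂ c₃
              :+ :- (con (ℤ.+ 1 / 64) :* (a :* a)) :* h₂ c₀ c₁ c₂ :+ :- n₁ a b :* h₂ c₂ c₃ c₄)
         refl a b (W (2 ℕ.+ n)) (B (2 ℕ.+ n)) (catalan n) (catalan (1 ℕ.+ n)) (catalan (2 ℕ.+ n)) (catalan (3 ℕ.+ n)) (catalan (4 ℕ.+ n)) ⟩
  ((ℤ.+ 1 / 32) * ν₋₁ a b - (ℤ.+ 1 / 64) * (a * a)) * H 2 (suc n) + - ((ℤ.+ 1 / 64) * (a * a)) * H 2 n + - ν₁ a b * H 2 (suc (suc n)) ∎
  where open ≡-Reasoning

square : ℕ → ℚ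
square k = ι k * ι k

moment₂ : ∀ r → Bounded (H 2) (λ n → moment square r n - meanSquare (α r) (4^ r) n)
-- For r = 0 the moment is (n+1)²C = W + B, in accordance with ν₋₁ = 1 and ν₀ = ν₁ = 0 at a = b = 1.
moment₂ zero    = Bounded-0 (λ n → trans
  (cong (_- meanSquare 1ℚ 1ℚ n) (moment-zero square n))
  (solve 3 (λ x c h₁ → let u = (con 1ℚ :+ x) :* c in
    (con 1ℚ :+ x) :* (con 1ℚ :+ x) :* c :- (con (1ℚ * 1ℚ) :* (x :* u) :+ con (ν₋₁ 1ℚ 1ℚ) :* u :+ con (ν₀ 1ℚ 1ℚ) :* c :+ con (ν₁ 1ℚ 1ℚ) :* h₁) := con 0ℚ)
    refl (ι n) (catalan n) (H 1 n)))
moment₂ (suc r) = Bounded-L-step 2 square r (meanSquare (α r) (4^ r)) (meanSquare (α (suc r)) (4^ (suc r))) (moment₂ r)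
  -- `meanSquare-step` evaluates `L` from index 1 on; a second `Bounded-suc` supplies index 0.
  (Bounded-suc {X = λ n → L (meanSquare (α r) (4^ r)) n - meanSquare (α (suc r)) (4^ (suc r)) (suc n)} (λ n → 0<H 2 (suc n))
    (Bounded-≗ (λ n → sym (meanSquare-step (α r) (4^ r) n))
      (Bounded-+ (Bounded-+
        (Bounded-scale ((ℤ.+ 1 / 32) * ν₋₁ (α r) (4^ r) - (ℤ.+ 1 / 64) * (α r * α r)) previous)
        (Bounded-scale (- ((ℤ.+ 1 / 64) * (α r * α r))) beforePrevious))
        (Bounded-scale (- ν₁ (α r) (4^ r)) same))))
  where
  same : Bounded (H 2 ∘ suc ∘ suc) (H 2 ∘ suc ∘ suc)
  same = Bounded-refl (λ n → <⇒≤ (0<H 2 (suc (suc n))))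
  previous : Bounded (H 2 ∘ suc ∘ suc) (H 2 ∘ suc)
  previous = Bounded-weaken (ι 4) (0≤ι 4) (λ n → H-≤-suc 2 (suc n)) (Bounded-refl (λ n → <⇒≤ (0<H 2 (suc n))))
  beforePrevious : Bounded (H 2 ∘ suc ∘ suc) (H 2)
  beforePrevious = Bounded-weaken (ι 4) (0≤ι 4) (λ n → H-≤-suc 2 (suc n))
    (Bounded-weaken (ι 4) (0≤ι 4) (H-≤-suc 2) (Bounded-H 2))

-- Division by the Catalan numbers

fromℚᵘ-+ : ∀ p q → fromℚᵘ p + fromℚᵘ q ≡ fromℚᵘ (p ℚᵘ.+ q)
fromℚᵘ-+ p q = toℚᵘ-injective (ℚᵘₚ.≃-trans (toℚᵘ-homo-+ (fromℚᵘ p) (fromℚᵘ q))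
  (ℚᵘₚ.≃-trans (ℚᵘₚ.+-cong (toℚᵘ-fromℚᵘ p) (toℚᵘ-fromℚᵘ q)) (ℚᵘₚ.≃-sym (toℚᵘ-fromℚᵘ (p ℚᵘ.+ q)))))

fromℚᵘ-* : ∀ p q → fromℚᵘ p * fromℚᵘ q ≡ fromℚᵘ (p ℚᵘ.* q)
fromℚᵘ-* p q = toℚᵘ-injective (ℚᵘₚ.≃-trans (toℚᵘ-homo-* (fromℚᵘ p) (fromℚᵘ q))
  (ℚᵘₚ.≃-trans (ℚᵘₚ.*-cong (toℚᵘ-fromℚᵘ p) (toℚᵘ-fromℚᵘ q)) (ℚᵘₚ.≃-sym (toℚᵘ-fromℚᵘ (p ℚᵘ.* q)))))

ℕ→ℚ≡ι : ∀ n → ℕ→ℚ n ≡ ι n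
ℕ→ℚ≡ι zero    = refl
ℕ→ℚ≡ι (suc n) = trans (sym (trans (fromℚᵘ-+ ℚᵘ.1ℚᵘ (ℚᵘ.mkℚᵘ (ℤ.+ n) 0)) (fromℚᵘ-cong {ℚᵘ.1ℚᵘ ℚᵘ.+ ℚᵘ.mkℚᵘ (ℤ.+ n) 0} {ℚᵘ.mkℚᵘ (ℤ.+ suc n) 0} (ℚᵘ.*≡* numerators))))
  (cong (1ℚ +_) (ℕ→ℚ≡ι n))
  where
  numerators : (ℤ.+ 1 ℤ.* ℤ.+ 1 ℤ.+ ℤ.+ n ℤ.* ℤ.+ 1) ℤ.* ℤ.+ 1 ≡ ℤ.+ suc n ℤ.* ℤ.+ 1
  numerators = cong (λ k → (ℤ.+ 1 ℤ.+ k) ℤ.* ℤ.+ 1) (ℤₚ.*-identityʳ (ℤ.+ n))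

ι-* : ∀ m n → ι (m ℕ.* n) ≡ ι m * ι n
ι-* zero    n = sym (*-zeroˡ (ι n))
ι-* (suc m) n = trans (ι-+ n (m ℕ.* n)) (trans (cong (ι n +_) (ι-* m n))
  (solve 2 (λ x y → y :+ x :* y := (con 1ℚ :+ x) :* y) refl (ι m) (ι n)))

ι-^ : ∀ r → ι (4 ℕ.^ r) ≡ 4^ r
ι-^ zero    = refl
ι-^ (suc r) = trans (ι-* 4 (4 ℕ.^ r)) (cong (4ℚ *_) (ι-^ r))

reciprocal : ∀ n .{{_ : ℕ.NonZero n}} → (ℤ.+ 1 / n) * ι n ≡ 1ℚ
reciprocal n@(suc m) = trans (cong ((ℤ.+ 1 / n) *_) (sym (ℕ→ℚ≡ι n)))
  (trans (fromℚᵘ-* (ℚᵘ.mkℚᵘ (ℤ.+ 1) m) (ℚᵘ.mkℚᵘ (ℤ.+ n) 0))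
         (fromℚᵘ-cong {ℚᵘ.mkℚᵘ (ℤ.+ 1) m ℚᵘ.* ℚᵘ.mkℚᵘ (ℤ.+ n) 0} {ℚᵘ.1ℚᵘ} (ℚᵘ.*≡* numerators)))
  where
  numerators : (ℤ.+ 1 ℤ.* ℤ.+ n) ℤ.* ℤ.+ 1 ≡ ℤ.+ 1 ℤ.* ℤ.+ (n ℕ.* 1)
  numerators = trans (ℤₚ.*-identityʳ _) (cong (λ k → ℤ.+ 1 ℤ.* ℤ.+ k) (sym (ℕₚ.*-identityʳ n)))

inverse-unique : ∀ {x y z} → x * y ≡ 1ℚ → z * y ≡ 1ℚ → x ≡ z
inverse-unique {x} {y} {z} xy≡1 zy≡1 = begin
  x            ≡⟨ *-identityʳ x ⟨
  x * 1ℚ       ≡⟨ cong (x *_) zy≡1 ⟨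
  x * (z * y)  ≡⟨ solve 3 (λ x y z → x :* (z :* y) := z :* (x :* y)) refl x y z ⟩
  z * (x * y)  ≡⟨ cong (z *_) xy≡1 ⟩
  z * 1ℚ       ≡⟨ *-identityʳ z ⟩
  z            ∎
  where open ≡-Reasoning

α-4^ : ∀ r → α r * 4^ r ≡ 1ℚ
α-4^ zero    = refl
α-4^ (suc r) = trans (solve 2 (λ x y → con ¼ℚ :* x :* (con 4ℚ :* y) := x :* y) refl (α r) (4^ r)) (α-4^ r)

inv4^≡α : ∀ r → inv4^ r ≡ α r
inv4^≡α r = inverse-unique {y = 4^ r}
  (subst (λ x → inv4^ r * x ≡ 1ℚ) (ι-^ r) (reciprocal (4 ℕ.^ r) {{ℕₚ.m^n≢0 4 r}})) (α-4^ r)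

recipℕ-inverse : ∀ n → 0ℚ < ι n → recipℕ n * ι n ≡ 1ℚ
recipℕ-inverse zero    0<0 = contradiction 0<0 (<-irrefl refl)
recipℕ-inverse (suc n) _   = reciprocal (suc n)

ι-sum : ∀ (f : Tree → ℕ) ts → ℕ→ℚ (sum (map f ts)) ≡ ∑ ts (λ t → ι (f t))
ι-sum f ts = trans (ℕ→ℚ≡ι (sum (map f ts))) (go ts)
  where
  go : ∀ ts → ι (sum (map f ts)) ≡ ∑ ts (λ t → ι (f t))
  go []       = refl
  go (t ∷ ts) = trans (ι-+ (f t) (sum (map f ts))) (cong (ι (f t) +_) (go ts))

ι-length : ∀ (ts : List Tree) → ι (length ts) ≡ ∑ ts (λ _ → 1ℚ)
ι-length []       = refl
ι-length (t ∷ ts) = cong (1ℚ +_) (ι-length ts)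

recipC : ℕ → ℚ
recipC n = recipℕ (length (treesOfSize n))

recipC-catalan : ∀ n → recipC n * catalan n ≡ 1ℚ
recipC-catalan n = trans (cong (recipC n *_) (sym (ι-length (treesOfSize n))))
  (recipℕ-inverse (length (treesOfSize n)) (subst (0ℚ <_) (sym (ι-length (treesOfSize n))) (0<catalan n)))

catalan-recipC : ∀ n → catalan n * recipC n ≡ 1ℚ
catalan-recipC n = trans (*-comm (catalan n) (recipC n)) (recipC-catalan n)

0<recipC : ∀ n → 0ℚ < recipC n
0<recipC n = 0<-cancelˡ (0<catalan n) (subst (0ℚ <_) (sym (catalan-recipC n)) (positive⁻¹ 1ℚ))

EX≡moment : ∀ r n → EX r n ≡ moment ι r n * recipC n
EX≡moment r n = cong (_* recipC n) (ι-sum (branches r) (treesOfSize n))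

EX²≡moment : ∀ r n → expect n (λ t → branches r t ℕ.* branches r t) ≡ moment square r n * recipC n
EX²≡moment r n = cong (_* recipC n) (trans (ι-sum (λ t → branches r t ℕ.* branches r t) (treesOfSize n))
  (∑-cong (treesOfSize n) (λ t → ι-* (branches r t) (branches r t))))

-- From here on, index n of a sequence stands for trees of size n + 1.
u : ℕ → ℚ
u n = recipℕ (suc n)

u-ι : ∀ n → u n * ι (suc n) ≡ 1ℚ
u-ι n = reciprocal (suc n)

0<u : ∀ n → 0ℚ < u n
0<u n = 0<-cancelˡ (0<ι-suc n) (subst (0ℚ <_) (sym (trans (*-comm (ι (suc n)) (u n)) (u-ι n))) (positive⁻¹ 1ℚ))

u≤1 : ∀ n → u n ≤ℚ 1ℚ
u≤1 n = begin
  u n              ≡⟨ *-identityʳ (u n) ⟨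
  u n * 1ℚ         ≤⟨ *-monoˡ-0≤ (<⇒≤ (0<u n)) (+-monoʳ-≤ 1ℚ (0≤ι n)) ⟩
  u n * ι (suc n)  ≡⟨ u-ι n ⟩
  1ℚ               ∎
  where open ≤-Reasoning

pow : ℕ → ℕ → ℚ
pow zero    n = 1ℚ
pow (suc j) n = u n * pow j n

0≤pow : ∀ j n → 0ℚ ≤ℚ pow j n
0≤pow zero    n = nonNegative⁻¹ 1ℚ
0≤pow (suc j) n = 0≤*0≤ (<⇒≤ (0<u n)) (0≤pow j n)

O : ℕ → (ℕ → ℚ) → Set
O j = Bounded (pow j)

O-const : ∀ x → O 0 (λ _ → x)
O-const x = ∣ x ∣ , 0≤∣p∣ x , λ n → ≤-reflexive (sym (*-identityʳ ∣ x ∣))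

O-u* : ∀ {j X} → O j X → O (suc j) (λ n → u n * X n)
O-u* = Bounded-* (Bounded-refl (λ n → <⇒≤ (0<u n)))

O-weaken : ∀ {j X} → O (suc j) X → O j X
O-weaken {j} = Bounded-weaken 1ℚ (nonNegative⁻¹ 1ℚ) (λ n → *-monoʳ-0≤ (0≤pow j n) (u≤1 n))

O-ι* : ∀ {j X} → O (suc j) X → O j (λ n → ι (suc n) * X n)
O-ι* {j} {X} (K , 0≤K , bound) = K , 0≤K , λ n → begin
  ∣ ι (suc n) * X n ∣                ≡⟨ ∣p*q∣≡∣p∣*∣q∣ (ι (suc n)) (X n) ⟩
  ∣ ι (suc n) ∣ * ∣ X n ∣            ≡⟨ cong (_* ∣ X n ∣) (0≤p⇒∣p∣≡p (0≤ι (suc n))) ⟩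
  ι (suc n) * ∣ X n ∣                ≤⟨ *-monoˡ-0≤ (0≤ι (suc n)) (bound n) ⟩
  ι (suc n) * (K * (u n * pow j n))  ≡⟨ solve 4 (λ m k u p → m :* (k :* (u :* p)) := (u :* m) :* (k :* p)) refl (ι (suc n)) K (u n) (pow j n) ⟩
  (u n * ι (suc n)) * (K * pow j n)  ≡⟨ cong (_* (K * pow j n)) (u-ι n) ⟩
  1ℚ * (K * pow j n)                 ≡⟨ *-identityˡ (K * pow j n) ⟩
  K * pow j n                        ∎
  where open ≤-Reasoning

h : ℕ → ℕ → ℚ
h k n = H k (suc n) * recipC (suc n)

0≤h : ∀ k n → 0ℚ ≤ℚ h k n
0≤h k n = 0≤*0≤ (<⇒≤ (0<H k (suc n))) (<⇒≤ (0<recipC (suc n)))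

h-zero : ∀ n → h 0 n ≡ 1ℚ
h-zero n = catalan-recipC (suc n)

-- The factor in `H-ratio` is k + 2 plus the size. Isolating the size and dividing by it leaves
-- `h (suc k)` on the right with an extra factor `u`, so iteration generates the expansion in powers
-- of 1/n.
h-suc : ∀ k n → h (suc k) n ≡ u n * ((4ℚ * ι k + 6ℚ) * h k n - ι (suc (suc k)) * h (suc k) n)
h-suc k n = begin
  H′ * j
    ≡⟨ *-identityˡ (H′ * j) ⟨
  1ℚ * (H′ * j)
    ≡⟨ cong (_* (H′ * j)) (u-ι n) ⟨
  (u n * ι (suc n)) * (H′ * j)
    ≡⟨ solve 5 (λ u m k h j → (u :* m) :* (h :* j) := u :* ((con 1ℚ :+ (con 1ℚ :+ (k :+ m))) :* h :* j :- (con 1ℚ :+ (con 1ℚ :+ k)) :* (h :* j)))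
         refl (u n) (ι (suc n)) (ι k) H′ j ⟩
  u n * ((1ℚ + (1ℚ + (ι k + ι (suc n)))) * H′ * j - ι (suc (suc k)) * (H′ * j))
    ≡⟨ cong (λ x → u n * ((1ℚ + (1ℚ + x)) * H′ * j - ι (suc (suc k)) * (H′ * j))) (ι-+ k (suc n)) ⟨
  u n * (ι (suc (suc (k ℕ.+ suc n))) * H′ * j - ι (suc (suc k)) * (H′ * j))
    ≡⟨ cong (λ x → u n * (x * j - ι (suc (suc k)) * (H′ * j))) (H-ratio k (suc n)) ⟩
  u n * ((4ℚ * ι k + 6ℚ) * H k (suc n) * j - ι (suc (suc k)) * (H′ * j))
    ≡⟨ cong (λ x → u n * (x - ι (suc (suc k)) * (H′ * j))) (*-assoc (4ℚ * ι k + 6ℚ) (H k (suc n)) j) ⟩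
  u n * ((4ℚ * ι k + 6ℚ) * h k n - ι (suc (suc k)) * h (suc k) n) ∎
  where
  open ≡-Reasoning
  H′ j : ℚ
  H′ = H (suc k) (suc n)
  j = recipC (suc n)

-- As `h` is nonnegative, dropping the subtracted term of `h-suc` only enlarges the right side.
O-h : ∀ k → O k (h k)
O-h zero    = Bounded-≗ (λ n → sym (h-zero n)) (O-const 1ℚ)
O-h (suc k) = Bounded-dominate dominated (O-u* {k} (Bounded-scale (4ℚ * ι k + 6ℚ) (O-h k)))
  where
  Bounded-dominate : ∀ {G X Y : ℕ → ℚ} → (∀ n → ∣ X n ∣ ≤ℚ ∣ Y n ∣) → Bounded G Y → Bounded G X
  Bounded-dominate X≤Y (K , 0≤K , bound) = K , 0≤K , λ n → ≤-trans (X≤Y n) (bound n)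
  x : ℚ
  x = 4ℚ * ι k + 6ℚ
  0≤x : 0ℚ ≤ℚ x
  0≤x = +-mono-≤ (0≤*0≤ (nonNegative⁻¹ 4ℚ) (0≤ι k)) (nonNegative⁻¹ 6ℚ)
  dominated : ∀ n → ∣ h (suc k) n ∣ ≤ℚ ∣ u n * (x * h k n) ∣
  dominated n = begin
    ∣ h (suc k) n ∣
      ≡⟨ 0≤p⇒∣p∣≡p (0≤h (suc k) n) ⟩
    h (suc k) n
      ≡⟨ h-suc k n ⟩
    u n * (x * h k n - ι (suc (suc k)) * h (suc k) n)
      ≤⟨ *-monoˡ-0≤ (<⇒≤ (0<u n)) (p-q≤p (0≤*0≤ (0≤ι (suc (suc k))) (0≤h (suc k) n))) ⟩
    u n * (x * h k n)
      ≡⟨ 0≤p⇒∣p∣≡p (0≤*0≤ (<⇒≤ (0<u n)) (0≤*0≤ 0≤x (0≤h k n))) ⟨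
    ∣ u n * (x * h k n) ∣ ∎
    where open ≤-Reasoning

h₁-expansion₁ : ∀ n → h 1 n ≡ 6ℚ * u n - 2ℚ * (u n * h 1 n)
h₁-expansion₁ n = trans (h-suc 0 n) (trans
  (cong (λ x → u n * ((4ℚ * 0ℚ + 6ℚ) * x - ι 2 * h 1 n)) (h-zero n))
  (solve 2 (λ u h → u :* (con (4ℚ * 0ℚ + 6ℚ) :* con 1ℚ :- con (ι 2) :* h) := con 6ℚ :* u :- con 2ℚ :* (u :* h)) refl (u n) (h 1 n)))

-- A second round of substitution, as the mean is compared through order u²; the variance uses
-- `h₁-expansion₁`.
h₁-expansion₂ : ∀ n → h 1 n ≡ 6ℚ * u n - (ℤ.+ 12 / 1) * (u n * u n) + 4ℚ * (u n * (u n * h 1 n))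
h₁-expansion₂ n = trans (h₁-expansion₁ n) (trans
  (cong (λ x → 6ℚ * u n - 2ℚ * (u n * x)) (h₁-expansion₁ n))
  (solve 2 (λ u h → con 6ℚ :* u :- con 2ℚ :* (u :* (con 6ℚ :* u :- con 2ℚ :* (u :* h))) :=
     con 6ℚ :* u :- con (ℤ.+ 12 / 1) :* (u :* u) :+ con 4ℚ :* (u :* (u :* h))) refl (u n) (h 1 n)))

h₂-expansion : ∀ n → h 2 n ≡ (ℤ.+ 60 / 1) * (u n * u n) - (ℤ.+ 20 / 1) * (u n * (u n * h 1 n)) - (ℤ.+ 3 / 1) * (u n * h 2 n)
h₂-expansion n = trans (h-suc 1 n) (trans
  (cong (λ x → u n * ((4ℚ * ι 1 + 6ℚ) * x - ι 3 * h 2 n)) (h₁-expansion₁ n))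
  (solve 3 (λ u h g → u :* (con (4ℚ * ι 1 + 6ℚ) :* (con 6ℚ :* u :- con 2ℚ :* (u :* h)) :- con (ι 3) :* g) :=
     con (ℤ.+ 60 / 1) :* (u :* u) :- con (ℤ.+ 20 / 1) :* (u :* (u :* h)) :- con (ℤ.+ 3 / 1) :* (u :* g)) refl (u n) (h 1 n) (h 2 n)))

O-divide : ∀ k {X} → Bounded (H k) X → O k (λ n → X (suc n) * recipC (suc n))
O-divide k {X} (K , 0≤K , bound) with O-h k
... | (K′ , 0≤K′ , bound′) = K * K′ , 0≤*0≤ 0≤K 0≤K′ , λ n → begin
  ∣ X (suc n) * recipC (suc n) ∣
    ≡⟨ ∣p*q∣≡∣p∣*∣q∣ (X (suc n)) (recipC (suc n)) ⟩
  ∣ X (suc n) ∣ * ∣ recipC (suc n) ∣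
    ≡⟨ cong (∣ X (suc n) ∣ *_) (0≤p⇒∣p∣≡p (<⇒≤ (0<recipC (suc n)))) ⟩
  ∣ X (suc n) ∣ * recipC (suc n)
    ≤⟨ *-monoʳ-0≤ (<⇒≤ (0<recipC (suc n))) (bound (suc n)) ⟩
  K * H k (suc n) * recipC (suc n)
    ≡⟨ *-assoc K (H k (suc n)) (recipC (suc n)) ⟩
  K * h k n
    ≡⟨ cong (K *_) (0≤p⇒∣p∣≡p (0≤h k n)) ⟨
  K * ∣ h k n ∣
    ≤⟨ *-monoˡ-0≤ 0≤K (bound′ n) ⟩
  K * (K′ * pow k n)
    ≡⟨ *-assoc K K′ (pow k n) ⟨
  K * K′ * pow k n ∎
  where open ≤-Reasoning

-- Expansion of the expectation

EXexpansion VXexpansion : (a b m i : ℚ) → ℚ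
EXexpansion a b m i =
  m * a
  + (ℤ.+ 1 / 6) * (1ℚ + (ℤ.+ 5 / 1) * a)
  + (ℤ.+ 1 / 20) * i * (b - a)
  + (ℤ.+ 1 / 12) * (i * i) * ((ℤ.+ 5 / 21) * (b * b) - (ℤ.+ 7 / 10) * b + (ℤ.+ 97 / 210) * a)
VXexpansion a b m i =
  ((b - 1ℚ) * (ℤ.+ 1 / 3) * (a * a)) * m
  - (2ℚ * (b * b) - (ℤ.+ 25 / 1) * b + (ℤ.+ 23 / 1)) * (ℤ.+ 1 / 90) * (a * a)
  - ((ℤ.+ 13 / 1) * (b * b * b) - (ℤ.+ 14 / 1) * (b * b) + (ℤ.+ 7 / 1) * b - 6ℚ) * (ℤ.+ 1 / 420) * (a * a) * i

4^≡ : ∀ r → ℕ→ℚ (4 ℕ.^ r) ≡ 4^ r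
4^≡ r = trans (ℕ→ℚ≡ι (4 ℕ.^ r)) (ι-^ r)

EXmain≡ : ∀ r n → EXmain r n ≡ EXexpansion (α r) (4^ r) (ι n) (recipℕ n)
EXmain≡ r n = trans
  (cong₂ (λ a b → EXexpansion a b (ℕ→ℚ n) (recipℕ n)) (inv4^≡α r) (4^≡ r))
  (cong (λ m → EXexpansion (α r) (4^ r) m (recipℕ n)) (ℕ→ℚ≡ι n))

VXmain≡ : ∀ r n → VXmain r n ≡ VXexpansion (α r) (4^ r) (ι n) (recipℕ n)
VXmain≡ r n = trans
  (cong₂ (λ a b → VXexpansion a b (ℕ→ℚ n) (recipℕ n)) (inv4^≡α r) (4^≡ r))
  (cong (λ m → VXexpansion (α r) (4^ r) m (recipℕ n)) (ℕ→ℚ≡ι n))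

EX-error : ∀ r → ℕ → ℚ
EX-error r n = (moment ι r (suc n) - mean (α r) (4^ r) (suc n)) * recipC (suc n)

EX²-error : ∀ r → ℕ → ℚ
EX²-error r n = (moment square r (suc n) - meanSquare (α r) (4^ r) (suc n)) * recipC (suc n)

EX-formula : ∀ r n → let a = α r ; b = 4^ r in
  EX r (suc n) ≡ a * (1ℚ + ι (suc n)) + μ₀ a b + μ₁ a b * h 1 n + μ₂ a b * h 2 n + EX-error r n
EX-formula r n = begin
  EX r (suc n)
    ≡⟨ EX≡moment r (suc n) ⟩
  M * j
    ≡⟨ solve 11 (λ M j a m C x y z H₁ H₂ one →
         let F = a :* ((one :+ m) :* C) :+ x :* C :+ y :* H₁ :+ z :* H₂ in
         M :* j := a :* (one :+ m) :* (C :* j) :+ x :* (C :* j) :+ y :* (H₁ :* j) :+ z :* (H₂ :* j) :+ (M :- F) :* j)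
         refl M j a m (catalan (suc n)) (μ₀ a b) (μ₁ a b) (μ₂ a b) (H 1 (suc n)) (H 2 (suc n)) 1ℚ ⟩
  a * (1ℚ + m) * (catalan (suc n) * j) + μ₀ a b * (catalan (suc n) * j) + μ₁ a b * h 1 n + μ₂ a b * h 2 n + EX-error r n
    ≡⟨ cong (λ e → a * (1ℚ + m) * e + μ₀ a b * e + μ₁ a b * h 1 n + μ₂ a b * h 2 n + EX-error r n) (catalan-recipC (suc n)) ⟩
  a * (1ℚ + m) * 1ℚ + μ₀ a b * 1ℚ + μ₁ a b * h 1 n + μ₂ a b * h 2 n + EX-error r n
    ≡⟨ cong₂ (λ x y → x + y + μ₁ a b * h 1 n + μ₂ a b * h 2 n + EX-error r n) (*-identityʳ (a * (1ℚ + m))) (*-identityʳ (μ₀ a b)) ⟩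
  a * (1ℚ + m) + μ₀ a b + μ₁ a b * h 1 n + μ₂ a b * h 2 n + EX-error r n ∎
  where
  open ≡-Reasoning
  M j a b m : ℚ
  M = moment ι r (suc n)
  j = recipC (suc n)
  a = α r
  b = 4^ r
  m = ι (suc n)

EX²-formula : ∀ r n → let a = α r ; b = 4^ r ; m = ι (suc n) in
  expect (suc n) (λ t → branches r t ℕ.* branches r t) ≡
  a * a * (m * (1ℚ + m)) + ν₋₁ a b * (1ℚ + m) + ν₀ a b + ν₁ a b * h 1 n + EX²-error r n
EX²-formula r n = begin
  expect (suc n) (λ t → branches r t ℕ.* branches r t)
    ≡⟨ EX²≡moment r (suc n) ⟩
  M * j
    ≡⟨ solve 10 (λ M j a m C x y z H₁ one →
         let F = a :* a :* (m :* ((one :+ m) :* C)) :+ x :* ((one :+ m) :* C) :+ y :* C :+ z :* H₁ in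
         M :* j := a :* a :* (m :* (one :+ m)) :* (C :* j) :+ x :* (one :+ m) :* (C :* j) :+ y :* (C :* j) :+ z :* (H₁ :* j) :+ (M :- F) :* j)
         refl M j a m (catalan (suc n)) (ν₋₁ a b) (ν₀ a b) (ν₁ a b) (H 1 (suc n)) 1ℚ ⟩
  a * a * (m * (1ℚ + m)) * (catalan (suc n) * j) + ν₋₁ a b * (1ℚ + m) * (catalan (suc n) * j) + ν₀ a b * (catalan (suc n) * j) + ν₁ a b * h 1 n + EX²-error r n
    ≡⟨ cong (λ e → a * a * (m * (1ℚ + m)) * e + ν₋₁ a b * (1ℚ + m) * e + ν₀ a b * e + ν₁ a b * h 1 n + EX²-error r n) (catalan-recipC (suc n)) ⟩
  a * a * (m * (1ℚ + m)) * 1ℚ + ν₋₁ a b * (1ℚ + m) * 1ℚ + ν₀ a b * 1ℚ + ν₁ a b * h 1 n + EX²-error r n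
    ≡⟨ cong (λ x → x + ν₋₁ a b * (1ℚ + m) * 1ℚ + ν₀ a b * 1ℚ + ν₁ a b * h 1 n + EX²-error r n)
         (*-identityʳ (a * a * (m * (1ℚ + m)))) ⟩
  a * a * (m * (1ℚ + m)) + ν₋₁ a b * (1ℚ + m) * 1ℚ + ν₀ a b * 1ℚ + ν₁ a b * h 1 n + EX²-error r n
    ≡⟨ cong₂ (λ x y → a * a * (m * (1ℚ + m)) + x + y + ν₁ a b * h 1 n + EX²-error r n)
         (*-identityʳ (ν₋₁ a b * (1ℚ + m))) (*-identityʳ (ν₀ a b)) ⟩
  a * a * (m * (1ℚ + m)) + ν₋₁ a b * (1ℚ + m) + ν₀ a b + ν₁ a b * h 1 n + EX²-error r n ∎
  where
  open ≡-Reasoning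
  M j a b m : ℚ
  M = moment square r (suc n)
  j = recipC (suc n)
  a = α r
  b = 4^ r
  m = ι (suc n)

-- The coefficients of the target are a + μ₀ at u⁰, 6μ₁ at u and 60μ₂ - 12μ₁ at u², so everything
-- through u² cancels, already with a and b independent.
EX-remainder : ∀ r n → let a = α r ; b = 4^ r in
  EX r (suc n) - EXmain r (suc n) ≡
  4ℚ * μ₁ a b * (u n * (u n * h 1 n)) + - ((ℤ.+ 20 / 1) * μ₂ a b) * (u n * (u n * h 1 n))
  + - ((ℤ.+ 3 / 1) * μ₂ a b) * (u n * h 2 n) + EX-error r n
EX-remainder r n = begin
  EX r (suc n) - EXmain r (suc n)
    ≡⟨ cong₂ _-_ (EX-formula r n) (EXmain≡ r (suc n)) ⟩
  a * (1ℚ + m) + μ₀ a b + μ₁ a b * h 1 n + μ₂ a b * h 2 n + e - EXexpansion a b m (u n)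
    ≡⟨ cong₂ (λ x y → a * (1ℚ + m) + μ₀ a b + μ₁ a b * x + μ₂ a b * y + e - EXexpansion a b m (u n))
         (h₁-expansion₂ n) (h₂-expansion n) ⟩
  a * (1ℚ + m) + μ₀ a b
    + μ₁ a b * (6ℚ * u n - (ℤ.+ 12 / 1) * (u n * u n) + 4ℚ * s)
    + μ₂ a b * ((ℤ.+ 60 / 1) * (u n * u n) - (ℤ.+ 20 / 1) * s - (ℤ.+ 3 / 1) * t) + e
    - EXexpansion a b m (u n)
    ≡⟨ solve 7 (λ a b m u s t e →
         let m₀ = con (ℤ.+ 1 / 6) :* (con 1ℚ :- a)
             m₁ = con (ℤ.+ 1 / 120) :* (b :- a)
             m₂ = con (ℤ.+ 1 / 3024) :* (b :* b) :+ con (ℤ.+ 1 / 1440) :* b :- con (ℤ.+ 31 / 30240) :* a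
         in a :* (con 1ℚ :+ m) :+ m₀
              :+ m₁ :* (con 6ℚ :* u :- con (ℤ.+ 12 / 1) :* (u :* u) :+ con 4ℚ :* s)
              :+ m₂ :* (con (ℤ.+ 60 / 1) :* (u :* u) :- con (ℤ.+ 20 / 1) :* s :- con (ℤ.+ 3 / 1) :* t) :+ e
              :- (m :* a :+ con (ℤ.+ 1 / 6) :* (con 1ℚ :+ con (ℤ.+ 5 / 1) :* a) :+ con (ℤ.+ 1 / 20) :* u :* (b :- a)
                  :+ con (ℤ.+ 1 / 12) :* (u :* u) :* (con (ℤ.+ 5 / 21) :* (b :* b) :- con (ℤ.+ 7 / 10) :* b :+ con (ℤ.+ 97 / 210) :* a)) :=
            con 4ℚ :* m₁ :* s :+ :- (con (ℤ.+ 20 / 1) :* m₂) :* s :+ :- (con (ℤ.+ 3 / 1) :* m₂) :* t :+ e)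
         refl a b m (u n) s t e ⟩
  4ℚ * μ₁ a b * s + - ((ℤ.+ 20 / 1) * μ₂ a b) * s + - ((ℤ.+ 3 / 1) * μ₂ a b) * t + e ∎
  where
  open ≡-Reasoning
  a b m s t e : ℚ
  a = α r
  b = 4^ r
  m = ι (suc n)
  s = u n * (u n * h 1 n)
  t = u n * h 2 n
  e = EX-error r n

EX-asymptotics : ∀ r → O 3 (λ n → EX r (suc n) - EXmain r (suc n))
EX-asymptotics r = Bounded-≗ (λ n → sym (EX-remainder r n))
  (Bounded-+ (Bounded-+ (Bounded-+
    (Bounded-scale (4ℚ * μ₁ a b) uuh₁)
    (Bounded-scale (- ((ℤ.+ 20 / 1) * μ₂ a b)) uuh₁))
    (Bounded-scale (- ((ℤ.+ 3 / 1) * μ₂ a b)) (O-u* {2} (O-h 2))))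
    (O-divide 3 (moment₁ r)))
  where
  a b : ℚ
  a = α r
  b = 4^ r
  uuh₁ : O 3 (λ n → u n * (u n * h 1 n))
  uuh₁ = O-u* {2} (O-u* {1} (O-h 1))

-- Expansion of the variance

γ δ′ : ℚ → ℚ → ℚ
γ  a b = (ℤ.+ 1 / 20) * (b - a)
δ′ a b = (ℤ.+ 1 / 12) * ((ℤ.+ 5 / 21) * (b * b) - (ℤ.+ 7 / 10) * b + (ℤ.+ 97 / 210) * a)

-- Apart from the leading term m a, the coefficients of u⁰, u and u² in `EXexpansion` are `β`, `γ`
-- and `δ′`.
β : ℚ → ℚ
β a = (ℤ.+ 1 / 6) * (1ℚ + (ℤ.+ 5 / 1) * a)

-- With a = 4⁻ʳ, b = 4ʳ, m = n and u = 1/n, both correction terms vanish.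
VX-identity : ∀ a b m u h →
  a * a * (m * (1ℚ + m)) + ν₋₁ a b * (1ℚ + m) + ν₀ a b + ν₁ a b * (6ℚ * u - 2ℚ * (u * h))
  - EXexpansion a b m u * EXexpansion a b m u - VXexpansion a b m u ≡
  - (2ℚ * ν₁ a b) * (u * h) + u * (u * (- (γ a b * γ a b + 2ℚ * (β a * δ′ a b)) + u * (- (2ℚ * (γ a b * δ′ a b)) + u * - (δ′ a b * δ′ a b))))
  + ((u * m - 1ℚ) * - (2ℚ * (a * γ a b) + 2ℚ * (a * δ′ a b) * u)
  + (a * b - 1ℚ) * ((ℤ.+ 13 / 420) * a * b * b * u + (ℤ.+ 1 / 45) * a * b + (ℤ.+ 1 / 60) * a * u - (ℤ.+ 1 / 30) * a * b * u
                    - (ℤ.+ 1 / 3) * a * m - (ℤ.+ 5 / 18) * a - (ℤ.+ 11 / 1260) * b * u - (ℤ.+ 7 / 90)))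
VX-identity = solve 5 (λ a b m u h →
  let n₋₁ = con (ℤ.+ 2 / 3) :* a :+ con (ℤ.+ 1 / 3) :* (a :* a)
      n₀ = con (ℤ.+ 19 / 180) :- con (ℤ.+ 1 / 9) :* a :+ con (ℤ.+ 1 / 180) :* (a :* a)
      n₁ = con (ℤ.+ 4 / 945) :* b :- con (ℤ.+ 1 / 180) :* a :+ con (ℤ.+ 1 / 756) :* (a :* a)
      P = con (ℤ.+ 5 / 21) :* (b :* b) :- con (ℤ.+ 7 / 10) :* b :+ con (ℤ.+ 97 / 210) :* a
      be = con (ℤ.+ 1 / 6) :* (con 1ℚ :+ con (ℤ.+ 5 / 1) :* a)
      ga = con (ℤ.+ 1 / 20) :* (b :- a)
      de = con (ℤ.+ 1 / 12) :* P
      E = m :* a :+ be :+ con (ℤ.+ 1 / 20) :* u :* (b :- a) :+ con (ℤ.+ 1 / 12) :* (u :* u) :* P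
      V = ((b :- con 1ℚ) :* con (ℤ.+ 1 / 3) :* (a :* a)) :* m
          :- (con 2ℚ :* (b :* b) :- con (ℤ.+ 25 / 1) :* b :+ con (ℤ.+ 23 / 1)) :* con (ℤ.+ 1 / 90) :* (a :* a)
          :- (con (ℤ.+ 13 / 1) :* (b :* b :* b) :- con (ℤ.+ 14 / 1) :* (b :* b) :+ con (ℤ.+ 7 / 1) :* b :- con 6ℚ) :* con (ℤ.+ 1 / 420) :* (a :* a) :* u
  in a :* a :* (m :* (con 1ℚ :+ m)) :+ n₋₁ :* (con 1ℚ :+ m) :+ n₀ :+ n₁ :* (con 6ℚ :* u :- con 2ℚ :* (u :* h)) :- E :* E :- V :=
     :- (con 2ℚ :* n₁) :* (u :* h) :+ u :* (u :* (:- (ga :* ga :+ con 2ℚ :* (be :* de)) :+ u :* (:- (con 2ℚ :* (ga :* de)) :+ u :* :- (de :* de))))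
     :+ ((u :* m :- con 1ℚ) :* :- (con 2ℚ :* (a :* ga) :+ con 2ℚ :* (a :* de) :* u)
     :+ (a :* b :- con 1ℚ) :* (con (ℤ.+ 13 / 420) :* a :* b :* b :* u :+ con (ℤ.+ 1 / 45) :* a :* b :+ con (ℤ.+ 1 / 60) :* a :* u :- con (ℤ.+ 1 / 30) :* a :* b :* u
          :- con (ℤ.+ 1 / 3) :* a :* m :- con (ℤ.+ 5 / 18) :* a :- con (ℤ.+ 11 / 1260) :* b :* u :- con (ℤ.+ 7 / 90)))) refl

error₁ : ℕ → ℕ → ℚ
error₁ r n = EX r (suc n) - EXmain r (suc n)

-- Squaring the mean E + ε gives the cross term 2Eε; the part m a of E is kept apart from the
-- bounded rest because it multiplies ε by the size.
VX-remainder : ∀ r n → let a = α r ; b = 4^ r in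
  VX r (suc n) - VXmain r (suc n) ≡
  - (2ℚ * ν₁ a b) * (u n * h 1 n) + u n * (u n * (- (γ a b * γ a b + 2ℚ * (β a * δ′ a b)) + u n * (- (2ℚ * (γ a b * δ′ a b)) + u n * - (δ′ a b * δ′ a b))))
  + EX²-error r n + (- (2ℚ * a) * (ι (suc n) * error₁ r n)
  + (- 1ℚ) * ((2ℚ * β a + 2ℚ * γ a b * u n + u n * (u n * (2ℚ * δ′ a b))) * error₁ r n + error₁ r n * error₁ r n))
VX-remainder r n = begin
  VX r (suc n) - VXmain r (suc n)
    ≡⟨ cong₂ (λ x y → x - EX r (suc n) * EX r (suc n) - y) (EX²-formula r n) (VXmain≡ r (suc n)) ⟩
  X (h 1 n) + e - EX r (suc n) * EX r (suc n) - V
    ≡⟨ cong₂ (λ x y → X x + e - y * y - V) (h₁-expansion₁ n)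
         (trans (split (EX r (suc n)) (EXmain r (suc n))) (cong (_+ ε) (EXmain≡ r (suc n)))) ⟩
  X y + e - (E + ε) * (E + ε) - V
    ≡⟨ solve 5 (λ X e E ε V → X :+ e :- (E :+ ε) :* (E :+ ε) :- V := (X :- E :* E :- V) :+ e :+ :- (con 2ℚ :* E :* ε :+ ε :* ε)) refl (X y) e E ε V ⟩
  (X y - E * E - V) + e + - (2ℚ * E * ε + ε * ε)
    -- The solver treats a, b, m and u as independent, so `VX-identity` carries explicit multipliers
    -- `p` of um - 1 and `q` of ab - 1.
    ≡⟨ cong (λ x → x + e + - (2ℚ * E * ε + ε * ε)) (VX-identity a b m (u n) (h 1 n)) ⟩
  main + ((u n * m - 1ℚ) * p + (a * b - 1ℚ) * q) + e + - (2ℚ * E * ε + ε * ε)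
    ≡⟨ cong₂ (λ x y → main + ((x - 1ℚ) * p + (y - 1ℚ) * q) + e + - (2ℚ * E * ε + ε * ε)) (u-ι n) (α-4^ r) ⟩
  main + ((1ℚ - 1ℚ) * p + (1ℚ - 1ℚ) * q) + e + - (2ℚ * E * ε + ε * ε)
    ≡⟨ solve 10 (λ main p q e ε a b m u P →
         let E = m :* a :+ con (ℤ.+ 1 / 6) :* (con 1ℚ :+ con (ℤ.+ 5 / 1) :* a) :+ con (ℤ.+ 1 / 20) :* u :* (b :- a) :+ con (ℤ.+ 1 / 12) :* (u :* u) :* P
             be = con (ℤ.+ 1 / 6) :* (con 1ℚ :+ con (ℤ.+ 5 / 1) :* a)
             ga = con (ℤ.+ 1 / 20) :* (b :- a)
             de = con (ℤ.+ 1 / 12) :* P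
         in main :+ (con (1ℚ - 1ℚ) :* p :+ con (1ℚ - 1ℚ) :* q) :+ e :+ :- (con 2ℚ :* E :* ε :+ ε :* ε) :=
            main :+ e :+ (:- (con 2ℚ :* a) :* (m :* ε)
              :+ con (- 1ℚ) :* ((con 2ℚ :* be :+ con 2ℚ :* ga :* u :+ u :* (u :* (con 2ℚ :* de))) :* ε :+ ε :* ε)))
         refl main p q e ε a b m (u n) ((ℤ.+ 5 / 21) * (b * b) - (ℤ.+ 7 / 10) * b + (ℤ.+ 97 / 210) * a) ⟩
  main + e + (- (2ℚ * a) * (m * ε)
    + (- 1ℚ) * ((2ℚ * β a + 2ℚ * γ a b * u n + u n * (u n * (2ℚ * δ′ a b))) * ε + ε * ε)) ∎
  where
  open ≡-Reasoning
  a b m e ε E V y p q main : ℚ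
  a = α r
  b = 4^ r
  m = ι (suc n)
  e = EX²-error r n
  ε = error₁ r n
  E = EXexpansion a b m (u n)
  V = VXexpansion a b m (u n)
  y = 6ℚ * u n - 2ℚ * (u n * h 1 n)
  p = - (2ℚ * (a * γ a b) + 2ℚ * (a * δ′ a b) * u n)
  q = (ℤ.+ 13 / 420) * a * b * b * u n + (ℤ.+ 1 / 45) * a * b + (ℤ.+ 1 / 60) * a * u n - (ℤ.+ 1 / 30) * a * b * u n
      - (ℤ.+ 1 / 3) * a * m - (ℤ.+ 5 / 18) * a - (ℤ.+ 11 / 1260) * b * u n - (ℤ.+ 7 / 90)
  main = - (2ℚ * ν₁ a b) * (u n * h 1 n) + u n * (u n * (- (γ a b * γ a b + 2ℚ * (β a * δ′ a b)) + u n * (- (2ℚ * (γ a b * δ′ a b)) + u n * - (δ′ a b * δ′ a b))))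
  X : ℚ → ℚ
  X x = a * a * (m * (1ℚ + m)) + ν₋₁ a b * (1ℚ + m) + ν₀ a b + ν₁ a b * x
  split : ∀ x y → x ≡ y + (x - y)
  split = solve 2 (λ x y → x := y :+ (x :- y)) refl

VX-asymptotics : ∀ r → O 2 (λ n → VX r (suc n) - VXmain r (suc n))
VX-asymptotics r = Bounded-≗ (λ n → sym (VX-remainder r n))
  (Bounded-+ (Bounded-+ (Bounded-+
    (Bounded-scale (- (2ℚ * ν₁ a b)) (O-u* {1} (O-h 1)))
    (O-u* {1} (O-u* {0} (affine (- (γ a b * γ a b + 2ℚ * (β a * δ′ a b)))
      (affine (- (2ℚ * (γ a b * δ′ a b))) (O-const (- (δ′ a b * δ′ a b))))))))
    (O-divide 2 (moment₂ r)))
    -- This factor of the size costs one order and consumes the O(n⁻³) precision of the mean.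
    (Bounded-+ (Bounded-scale (- (2ℚ * a)) (O-ι* {2} (EX-asymptotics r)))
      (Bounded-scale (- 1ℚ) (Bounded-+ (small (Bounded-+ (Bounded-+ (O-const (2ℚ * β a)) (Bounded-scale (2ℚ * γ a b) O-u))
          (O-weaken {0} (O-u* {0} (O-weaken {0} (O-u* {0} (O-const (2ℚ * δ′ a b))))))))
        (small (O-weaken {0} (O-weaken {1} (O-weaken {2} (EX-asymptotics r)))))))))
  where
  a b : ℚ
  a = α r
  b = 4^ r
  affine : ∀ x {X} → O 0 X → O 0 (λ n → x + u n * X n)
  affine x bd = Bounded-+ (O-const x) (O-weaken {0} (O-u* {0} bd))
  O-u : O 0 u
  O-u = O-weaken {0} (Bounded-≗ (λ n → *-identityʳ (u n)) (O-u* {0} (O-const 1ℚ)))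
  small : ∀ {X : ℕ → ℚ} → O 0 X → O 2 (λ n → X n * error₁ r n)
  small bd = Bounded-weaken 1ℚ (nonNegative⁻¹ 1ℚ) (λ n → ≤-reflexive refl) (Bounded-* bd (O-weaken {2} (EX-asymptotics r)))

eventually : ∀ {X G : ℕ → ℚ} → Bounded (G ∘ suc) (X ∘ suc) → ∃[ C ] ∃[ N ] ∀ n → N ≤ n → ∣ X n ∣ ≤ℚ C * G n
-- Size 0 is excluded by the threshold 1: there `recipℕ` is 0 by convention, and the bound would
-- demand an exact equality.
eventually (K , _ , bound) = K , 1 , λ { (suc n) (s≤s _) → bound n }

theorem2p6 : (r : ℕ) →
    (∃[ C ] ∃[ N ] ∀ n → N ≤ n →
    ∣ EX r n - EXmain r n ∣ ≤ℚ C * (recipℕ n * recipℕ n * recipℕ n))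
    × (∃[ C ] ∃[ N ] ∀ n → N ≤ n →
    ∣ VX r n - VXmain r n ∣ ≤ℚ C * (recipℕ n * recipℕ n))
theorem2p6 r =
  eventually {λ n → EX r n - EXmain r n} {λ n → recipℕ n * recipℕ n * recipℕ n}
    (Bounded-weaken 1ℚ (nonNegative⁻¹ 1ℚ) (λ n → ≤-reflexive (cube (u n))) (EX-asymptotics r)) ,
  eventually {λ n → VX r n - VXmain r n} {λ n → recipℕ n * recipℕ n}
    (Bounded-weaken 1ℚ (nonNegative⁻¹ 1ℚ) (λ n → ≤-reflexive (sq (u n))) (VX-asymptotics r))
  where
  cube : ∀ x → x * (x * (x * 1ℚ)) ≡ 1ℚ * (x * x * x)
  cube = solve 1 (λ x → x :* (x :* (x :* con 1ℚ)) := con 1ℚ :* (x :* x :* x)) refl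
  sq : ∀ x → x * (x * 1ℚ) ≡ 1ℚ * (x * x)
  sq = solve 1 (λ x → x :* (x :* con 1ℚ) := con 1ℚ :* (x :* x)) refl
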